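{- Let $G$ be a connected threshold graph with vertex set $[n]$ split into intervals $I_0,\dots,I_k$ by vertex type, with $k>2$, and let $1\le t\le k-2$. Then the eigenpolytope $P_t$ is a simplex, but there are faces of $P_t$ of dimension at least $1$ that have points of the eigenconfiguration $\mathcal{B}_t=\{b_1,\dots,b_n\}$ in their relative interior. For every such face $F$ and every uniformly weighted design $W\subset[n]$ of $G$ of strength $t$, the set $W$ contains all or none of the indices $i\in[n]$ with $b_i\in F$. In particular, some facet of $P_t$ has a normal vector that is not a $2$-witness direction of $\mathcal{B}_t$, and thus there is a minimal positively weighted design of $G$ of strength $t$ that is not uniformly weighted.
   Context: A threshold graph is a graph with vertices $1,\dots,n$ such that each vertex $i$ is either connected to all vertices before it (a dominating vertex) or to none of the vertices before it (an isolated vertex). The set $[n]=\{1,\dots,n\}$ is split into intervals of consecutive integers $I_0,\dots,I_k$ (in increasing order) by vertex type: $I_0=\{1\}$, and $I_1,\dots,I_k$ are the maximal runs of consecutive vertices of the same type (all dominating or all isolated) among $2,\dots,n$, so consecutive intervals among $I_1,\dots,I_k$ have different types. It is a known fact that the Laplacian of a connected threshold graph has exactly $k+1$ distinct eigenvalues. The Laplacian $L$ is the $n\times n$ matrix with $L_{ii}=\deg(i)$, $L_{ij}=-1$ if $\{i,j\}$ is an edge, and $L_{ij}=0$ otherwise. Let $0=\lambda_0<\lambda_1<\cdots<\lambda_k$ be its distinct eigenvalues, with eigenspaces $E_0,\dots,E_k\subset\mathbb{R}^n$ (vectors are viewed as functions $[n]\to\mathbb{R}$). A subset $W\subset[n]$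 with weights $a_w\in\mathbb{R}$ ($w\in W$) averages $f:[n]\to\mathbb{R}$ if $\frac1n\sum_{v\in[n]}f(v)=\sum_{w\in W}a_wf(w)$. It is a graphical design of strength $t$ if it averages every $f\in E_0\oplus\cdots\oplus E_t$. It is positively weighted if $a_w>0$ for all $w\in W$, and uniformly weighted if there is $a>0$ with $a_w=a$ for all $w\in W$; a set $W$ is called a positively (uniformly) weighted design if it is one for some such weights. A positively weighted design $W$ of strength $t$ is minimal if no proper subset of $W$ is a positively weighted design of strength $t$. Let $\beta=\sum_{i=t+1}^k\dim E_i$ and let $B\in\mathbb{R}^{\beta\times n}$ be a matrix whose rows are the union of chosen bases of $E_{t+1},\dots,E_k$ (the choice is arbitrary). The $t$-th eigenconfiguration $\mathcal{B}_t=\{b_1,\dots,b_n\}\subset\mathbb{R}^\beta$ is the multiset of columns of $B$, and the $t$-th eigenpolytope is $P_t=\operatorname{conv}(\mathcal{B}_t)$, which is $\beta$-dimensional. A vector $a\in\mathbb{R}^\beta$ is a $2$-witness direction of $\mathcal{B}_t$ if $a^\top x$ takes exactly two values on the points of $\mathcal{B}_t$. -}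

module Defs where

open import Level using (Level; _⊔_) renaming (zero to lzero; suc to lsuc)
open import Algebra.Bundles using (CommutativeRing)
import Algebra.Properties.Semiring.Mult as SemiringMult
import Algebra.Properties.Semiring.Sum as SemiringSum
open import Data.Bool.Base using (Bool; true; false; if_then_else_)
open import Data.Fin.Base using (Fin; toℕ)
import Data.Fin.Base as Fin
import Data.Fin.Properties as Fin
open import Data.Fin.Subset using (Subset; _∈_; _⊂_; ∣_∣)
open import Data.Nat.Base as ℕ using (ℕ)
open import Data.Product.Base using (Σ; ∃-syntax; _×_)
open import Data.Sum.Base using (_⊎_)
open import Data.Vec.Base using (tabulate; lookup)
open import Data.Vec.Functional using (Vector)
open import Function.Bundles using (_⇔_)
open import Relation.Binary.Core using (Rel)
open import Relation.Binary.Structures using (IsStrictTotalOrder)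
open import Relation.Binary.PropositionalEquality.Core using (_≡_)
import Relation.Binary.Construct.StrictToNonStrict as ToNonStrict
open import Relation.Binary.Construct.Closure.ReflexiveTransitive using (Star)
open import Relation.Nullary.Decidable.Core using (⌊_⌋)
open import Relation.Nullary.Negation.Core using (¬_)
open import Relation.Unary using (Pred; _≐_)

-- Linearly ordered fields; they play the role of ℝ.  None of the notions below
-- refers to completeness, so ℝ is covered as one particular instance.
record OrderedField c ℓ₁ ℓ₂ : Set (lsuc (c ⊔ ℓ₁ ⊔ ℓ₂)) where
  field
    commutativeRing : CommutativeRing c ℓ₁

  open CommutativeRing commutativeRing public

  infix 4 _<_
  infix 9 _⁻¹
  field
    _<_                : Rel Carrier ℓ₂
    isStrictTotalOrder : IsStrictTotalOrder _≈_ _<_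
    0<1                : 0# < 1#
    +-monoˡ-<          : ∀ {x y} z → x < y → x + z < y + z
    *-pos              : ∀ {x y} → 0# < x → 0# < y → 0# < x * y
    -- 0# ⁻¹ is left unspecified
    _⁻¹                : Carrier → Carrier
    *-inverseʳ         : ∀ {x} → ¬ (x ≈ 0#) → x * x ⁻¹ ≈ 1#

  open ToNonStrict _≈_ _<_ public using (_≤_)

-- Finite simple graphs on the vertices 0, …, n − 1 (for 1, …, n).
record Graph (n : ℕ) : Set where
  field
    adj    : Fin n → Fin n → Bool
    sym    : ∀ i j → adj i j ≡ adj j i
    irrefl : ∀ i → adj i i ≡ false

  Connected : Set
  Connected = ∀ i j → Star (λ u v → adj u v ≡ true) i j

  degree : Fin n → ℕ
  degree i = ∣ tabulate (adj i) ∣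

  Dominating : Fin n → Set
  Dominating i = ∀ j → j Fin.< i → adj i j ≡ true

  Isolated : Fin n → Set
  Isolated i = ∀ j → j Fin.< i → adj i j ≡ false

  IsThreshold : Set
  IsThreshold = ∀ i → Dominating i ⊎ Isolated i

  SameType : Fin n → Fin n → Set
  SameType i j = (Dominating i × Dominating j) ⊎ (Isolated i × Isolated j)

-- The splitting of the vertices into intervals I₀, …, I_k, given by the index of
-- the interval containing each vertex.
record IntervalSplitting {n : ℕ} (G : Graph n) (k : ℕ) : Set where
  open Graph G
  field
    interval : Fin n → Fin (ℕ.suc k)
    nonempty : ∀ m → ∃[ i ] interval i ≡ m
    monotone : ∀ i j → i Fin.≤ j → interval i Fin.≤ interval j
    first    : ∀ i → interval i ≡ Fin.zero ⇔ toℕ i ≡ 0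
    -- Neighbouring vertices other than the first one share an interval exactly
    -- when they have the same type, so I₁, …, I_k are the maximal runs.
    runs     : ∀ i j → 0 ℕ.< toℕ i → toℕ j ≡ ℕ.suc (toℕ i) →
               interval i ≡ interval j ⇔ SameType i j

module Eigenpolytopes {c ℓ₁ ℓ₂ : Level} (𝕂 : OrderedField c ℓ₁ ℓ₂) where

  open OrderedField 𝕂
  open SemiringSum semiring using (sum)
  open SemiringMult semiring using () renaming (_×_ to _·_)

  Vec : ℕ → Set c
  Vec = Vector Carrier

  infix 4 _≋_
  _≋_ : ∀ {d} → Rel (Vec d) ℓ₁
  x ≋ y = ∀ r → x r ≈ y r

  𝟎 : ∀ {d} → Vec d
  𝟎 _ = 0#

  infix 8 _∙_
  _∙_ : ∀ {d} → Vec d → Vec d → Carrier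
  x ∙ y = sum (λ r → x r * y r)

  linComb : ∀ {m d} → Vec m → Vector (Vec d) m → Vec d
  linComb w p r = sum (λ i → w i * p i r)

  laplacian : ∀ {n} → Graph n → Vector (Vec n) n
  laplacian G i j =
    if ⌊ i Fin.≟ j ⌋ then Graph.degree G i · 1#
    else if Graph.adj G i j then - 1# else 0#

  Eigenspace : ∀ {n} → Graph n → Carrier → Pred (Vec n) ℓ₁
  Eigenspace G μ f = ∀ v → laplacian G v ∙ f ≈ μ * f v

  IsEigenvalue : ∀ {n} → Graph n → Carrier → Set (c ⊔ ℓ₁)
  IsEigenvalue {n} G μ = ∃[ f ] Eigenspace {n} G μ f × ¬ (f ≋ 𝟎)

  -- The distinct Laplacian eigenvalues 0 = λ₀ < λ₁ < ⋯ < λ_k.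
  record Spectrum {n : ℕ} (G : Graph n) (k : ℕ) : Set (c ⊔ ℓ₁ ⊔ ℓ₂) where
    field
      eigenvalue : Fin (ℕ.suc k) → Carrier
      zeroth     : eigenvalue Fin.zero ≈ 0#
      increasing : ∀ i j → i Fin.< j → eigenvalue i < eigenvalue j
      exhaustive : ∀ μ → IsEigenvalue G μ ⇔ (∃[ i ] μ ≈ eigenvalue i)

    E : Fin (ℕ.suc k) → Pred (Vec n) ℓ₁
    E i = Eigenspace G (eigenvalue i)

    -- E₀ ⊕ ⋯ ⊕ E_t
    LowSum : ℕ → Pred (Vec n) (c ⊔ ℓ₁)
    LowSum t f = Σ (Vector (Vec n) (ℕ.suc k)) λ g →
      (∀ i → E i (g i)) ×
      (∀ i → t ℕ.< toℕ i → g i ≋ 𝟎) ×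
      (∀ v → f v ≈ sum (λ i → g i v))

  -- Only the weights a w with w ∈ W matter.
  Averages : ∀ {n} → Subset n → Vec n → Vec n → Set ℓ₁
  Averages {n} W a f =
    (n · 1#) ⁻¹ * sum f ≈ sum (λ v → if lookup W v then a v * f v else 0#)

  module Designs {n k : ℕ} {G : Graph n} (S : Spectrum G k) (t : ℕ) where

    IsDesign : Subset n → Vec n → Set (c ⊔ ℓ₁)
    IsDesign W a = ∀ f → Spectrum.LowSum S t f → Averages W a f

    PositiveDesign : Subset n → Set (c ⊔ ℓ₁ ⊔ ℓ₂)
    PositiveDesign W = ∃[ a ] (∀ w → w ∈ W → 0# < a w) × IsDesign W a

    UniformDesign : Subset n → Set (c ⊔ ℓ₁ ⊔ ℓ₂)
    UniformDesign W = ∃[ α ] 0# < α × IsDesign W (λ _ → α)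

    MinimalPositiveDesign : Subset n → Set (c ⊔ ℓ₁ ⊔ ℓ₂)
    MinimalPositiveDesign W =
      PositiveDesign W × (∀ W′ → W′ ⊂ W → ¬ PositiveDesign W′)

  -- The subfamily (b r) for r ∈ S is a basis of the subspace U.
  record IsBasisOn {β n : ℕ} (S : Pred (Fin β) lzero)
                   (b : Vector (Vec n) β) (U : Pred (Vec n) ℓ₁) : Set (c ⊔ ℓ₁) where
    Supported : Vec β → Set ℓ₁
    Supported w = ∀ r → ¬ S r → w r ≈ 0#

    field
      members     : ∀ r → S r → U (b r)
      independent : ∀ w → Supported w → linComb w b ≋ 𝟎 → w ≋ 𝟎
      spanning    : ∀ f → U f → ∃[ w ] Supported w × f ≋ linComb w b

  -- B is a matrix whose rows are the union of bases of E_{t+1}, …, E_k, in any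
  -- order; block r says to which of these bases row r belongs.  In particular
  -- β = dim E_{t+1} + ⋯ + dim E_k.
  record IsEigenbasisMatrix {n k β : ℕ} {G : Graph n} (S : Spectrum G k) (t : ℕ)
                            (B : Vector (Vec n) β) : Set (c ⊔ ℓ₁) where
    field
      block : Fin β → Fin (ℕ.suc k)
      above : ∀ r → t ℕ.< toℕ (block r)
      basis : ∀ i → t ℕ.< toℕ i →
              IsBasisOn (λ r → block r ≡ i) B (Spectrum.E S i)

  columns : ∀ {β n} → Vector (Vec n) β → Vector (Vec β) n
  columns B i r = B r i

  conv : ∀ {m d} → Vector (Vec d) m → Pred (Vec d) (c ⊔ ℓ₁ ⊔ ℓ₂)
  conv p x = ∃[ w ] (∀ i → 0# ≤ w i) × sum w ≈ 1# × x ≋ linComb w p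

  AffinelyIndependent : ∀ {m d} → Vector (Vec d) m → Set (c ⊔ ℓ₁)
  AffinelyIndependent p = ∀ w → sum w ≈ 0# → linComb w p ≋ 𝟎 → w ≋ 𝟎

  module _ {d : ℕ} {ℓ : Level} where

    affineHull : Pred (Vec d) ℓ → Pred (Vec d) (c ⊔ ℓ₁ ⊔ ℓ)
    affineHull X x = ∃[ m ] Σ (Vector (Vec d) m) λ p → ∃[ w ]
      (∀ i → X (p i)) × sum w ≈ 1# × x ≋ linComb w p

    -- X contains an affine basis of its affine hull with m + 1 points.
    HasDimension : Pred (Vec d) ℓ → ℕ → Set (c ⊔ ℓ₁ ⊔ ℓ)
    HasDimension X m = Σ (Vector (Vec d) (ℕ.suc m)) λ p →
      AffinelyIndependent p × (∀ i → X (p i)) ×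
      (∀ x → X x → ∃[ w ] sum w ≈ 1# × x ≋ linComb w p)

    -- The interior in the affine hull, for the product topology.
    RelativeInterior : Pred (Vec d) ℓ → Pred (Vec d) (c ⊔ ℓ₁ ⊔ ℓ₂ ⊔ ℓ)
    RelativeInterior X x = X x × ∃[ ε ] 0# < ε ×
      (∀ y → affineHull X y → (∀ r → y r - x r < ε × x r - y r < ε) → X y)

    IsSimplex : Pred (Vec d) ℓ → Set (c ⊔ ℓ₁ ⊔ ℓ₂ ⊔ ℓ)
    IsSimplex X = ∃[ m ] Σ (Vector (Vec d) (ℕ.suc m)) λ p →
      AffinelyIndependent p × X ≐ conv p

  module _ {d : ℕ} {ℓ ℓ′ : Level} (P : Pred (Vec d) ℓ) (F : Pred (Vec d) ℓ′) where

    -- F is the face of P on which the inequality a ∙ x ≤ γ, valid on P, is tight.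
    IsFaceCutBy : Vec d → Carrier → Set (c ⊔ ℓ₁ ⊔ ℓ₂ ⊔ ℓ ⊔ ℓ′)
    IsFaceCutBy a γ = (∀ x → P x → a ∙ x ≤ γ) × F ≐ (λ x → P x × a ∙ x ≈ γ)

    IsFace : Set (c ⊔ ℓ₁ ⊔ ℓ₂ ⊔ ℓ ⊔ ℓ′)
    IsFace = ∃[ a ] ∃[ γ ] IsFaceCutBy a γ

    IsFacet : Set (c ⊔ ℓ₁ ⊔ ℓ₂ ⊔ ℓ ⊔ ℓ′)
    IsFacet = IsFace × ∃[ m ] HasDimension P (ℕ.suc m) × HasDimension F m

    IsNormal : Vec d → Set (c ⊔ ℓ₁ ⊔ ℓ₂ ⊔ ℓ ⊔ ℓ′)
    IsNormal a = ¬ (a ≋ 𝟎) × ∃[ γ ] IsFaceCutBy a γ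

  -- Faces of conv b of dimension at least 1 with a point of the configuration b
  -- in their relative interior.
  IsInteriorFace : ∀ {m d ℓ} → Vector (Vec d) m → Pred (Vec d) ℓ →
                   Set (c ⊔ ℓ₁ ⊔ ℓ₂ ⊔ ℓ)
  IsInteriorFace b F =
    IsFace (conv b) F ×
    (∃[ e ] 1 ℕ.≤ e × HasDimension F e) ×
    (∃[ i ] RelativeInterior F (b i))

  IsTwoWitness : ∀ {m d} → Vector (Vec d) m → Vec d → Set (c ⊔ ℓ₁)
  IsTwoWitness b a = ∃[ γ ] ∃[ δ ] ¬ (γ ≈ δ) ×
    (∃[ i ] a ∙ b i ≈ γ) × (∃[ i ] a ∙ b i ≈ δ) ×
    (∀ i → a ∙ b i ≈ γ ⊎ a ∙ b i ≈ δ)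

module Submission where

open import Defs
open import Level using (Level; _⊔_)
open import Algebra.Bundles using (CommutativeRing)
import Algebra.Properties.Ring
import Algebra.Properties.Semiring.Mult
import Algebra.Properties.Semiring.Mult.TCOptimised
import Algebra.Properties.Semiring.Sum
import Algebra.Solver.Ring
open import Algebra.Solver.Ring.AlmostCommutativeRing using (fromCommutativeRing; _-Raw-AlmostCommutative⟶_)
open import Data.Bool.Base using (Bool; true; false; if_then_else_; not; _∧_; _∨_)
import Data.Bool.Properties as Bool
open import Data.Empty using (⊥; ⊥-elim)
open import Data.Fin.Base as Fin using (Fin; zero; suc; toℕ)
import Data.Fin.Properties as Fin
open import Data.Fin.Subset using (Subset; _∈_; _∉_; _⊂_; ∣_∣)
open import Data.Integer.Base as ℤ using (ℤ; +_; -[1+_])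
import Data.Integer.Properties as ℤ
open import Data.Maybe.Base using (Maybe; just; nothing)
open import Data.Nat.Base as ℕ using (ℕ; zero; suc; z≤n; s≤s)
import Data.Nat.Properties as ℕ
open import Data.Product.Base using (Σ; ∃-syntax; _×_; _,_; proj₁; proj₂)
import Data.Sign.Base as Sign
open import Data.Sum.Base using (_⊎_; inj₁; inj₂)
open import Data.Vec.Base as Vec using (tabulate; lookup)
open import Data.Vec.Functional using (Vector; []; _∷_)
open import Data.Vec.Properties using (lookup∘tabulate; []=⇒lookup; lookup⇒[]=)
open import Function.Base using (_∘_)
open import Function.Bundles using (Equivalence)
open import Relation.Binary.Construct.Closure.ReflexiveTransitive using (Star; _◅_) renaming (ε to stop)
import Relation.Binary.Construct.StrictToNonStrict as ToNonStrict
open import Relation.Binary.Definitions using (Tri; tri<; tri≈; tri>)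
open import Relation.Binary.PropositionalEquality as ≡ using (_≡_; _≢_)
import Relation.Binary.Reasoning.Setoid
open import Relation.Binary.Structures using (IsStrictTotalOrder)
open import Relation.Nullary using (Dec; yes; no; ¬_)
open import Relation.Nullary.Decidable using (⌊_⌋)
open import Relation.Unary using (Pred; _≐_; _⊆_)

-- The functions 1_{v < i} − i 1_{v = i} are Laplacian eigenvectors of every threshold
-- graph; call i high or low according to the position of its eigenvalue.  Every
-- function orthogonal to the low ones has, at each low i ≥ 1, the average of its
-- values before i.  Applied to the rows of B this says that b_i is the average of the
-- b_j with j < i, so P_t is spanned by b_0 and the high b_i.  Their barycentric
-- coordinates obey the same averaging rule, which makes them affine functions on the
-- configuration, and hence these points are affinely independent.
-- Let i₀ be the last isolated vertex and j₀ the last dominating vertex before it.  No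
-- nonzero eigenvalue is below that of i₀ and only n is above that of j₀, so i₀ is low,
-- j₀ is high, and b_{i₀} lies in the relative interior of the face spanned by b_0 and
-- the high b_j with j < i₀.
-- The weight of a uniform design is an affine function on the configuration with
-- values in {0, α}, so it is extremal at a point b_i and, if b_i is in the relative
-- interior of a face, constant on that face.
-- Finally, the barycentric coordinate of b_0 takes the values 1 at b_0, 0 at
-- b_{j₀}, and something strictly between at b_{i₀}; normalised, it is the weight of a
-- minimal positive design, supported on the low vertices and not uniform.

-- The chosen bases enter only through their spans. A function satisfying the averaging rule is
-- orthogonal to every low `u i`, so its expansion in the orthogonal basis leaves a constant and
-- multiples of high `u i`, and these lie in the row space of `B`. Affine functions on the
-- configuration are therefore the same as functions with the averaging rule. Points, barycentric
-- coordinates and design weights all become solutions of one recursion along the vertex order with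
-- free values on `V`, and uniqueness, nonnegativity and strict positivity propagate along it. The
-- first vertex must belong to `V`: its `u` is zero, it carries no eigenvalue, and the recursion
-- starts there. The bounds on k and t place `i₀` and `j₀`. For k > 2 the last intervals contain a
-- dominating vertex, not the first one, followed by an isolated one. As t ≥ 1, the smallest nonzero
-- eigenvalue is low. As t ≤ k - 2, two distinct eigenvalues lie above level t; if `j₀` were low,
-- both would equal n.

module IntegerCoefficients {c ℓ} (R : CommutativeRing c ℓ) where
  open CommutativeRing R
  open Algebra.Properties.Ring ring
  open Algebra.Properties.Semiring.Mult.TCOptimised semiring renaming (_×_ to _·_)
  open Relation.Binary.Reasoning.Setoid setoid

  fromℤ : ℤ → Carrier
  fromℤ (+ n)    = n · 1#
  fromℤ -[1+ n ] = - (suc n · 1#)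

  private
    1+- : ∀ x y z → (z + x) - (z + y) ≈ x - y
    1+- x y z = begin
      (z + x) - (z + y)        ≈⟨ +-cong (+-comm z x) (-‿cong (+-comm z y)) ⟩
      (x + z) - (y + z)        ≈⟨ +-congˡ (sym (-‿+-comm y z)) ⟩
      (x + z) + (- y + - z)    ≈⟨ +-congˡ (+-comm (- y) (- z)) ⟩
      (x + z) + (- z + - y)    ≈⟨ +-assoc x z _ ⟩
      x + (z + (- z + - y))    ≈⟨ +-congˡ (sym (+-assoc z (- z) (- y))) ⟩
      x + ((z - z) + - y)      ≈⟨ +-congˡ (+-congʳ (-‿inverseʳ z)) ⟩
      x + (0# + - y)           ≈⟨ +-congˡ (+-identityˡ (- y)) ⟩
      x - y                    ∎

  fromℤ-⊖ : ∀ m n → fromℤ (m ℤ.⊖ n) ≈ m · 1# - n · 1#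
  fromℤ-⊖ m       zero    = sym (trans (+-congˡ -0#≈0#) (+-identityʳ _))
  fromℤ-⊖ zero    (suc n) = sym (+-identityˡ _)
  fromℤ-⊖ (suc m) (suc n) = begin
    fromℤ (suc m ℤ.⊖ suc n)        ≡⟨ ≡.cong fromℤ (ℤ.[1+m]⊖[1+n]≡m⊖n m n) ⟩
    fromℤ (m ℤ.⊖ n)                ≈⟨ fromℤ-⊖ m n ⟩
    m · 1# - n · 1#                ≈⟨ 1+- _ _ 1# ⟨
    (1# + m · 1#) - (1# + n · 1#)  ≈⟨ +-cong (1+× m 1#) (-‿cong (1+× n 1#)) ⟨
    suc m · 1# - suc n · 1#        ∎

  fromℤ-+ : ∀ i j → fromℤ (i ℤ.+ j) ≈ fromℤ i + fromℤ j
  fromℤ-+ (+ m)    (+ n)    = ×-homo-+ 1# m n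
  fromℤ-+ (+ m)    -[1+ n ] = fromℤ-⊖ m (suc n)
  fromℤ-+ -[1+ m ] (+ n)    = trans (fromℤ-⊖ n (suc m)) (+-comm _ _)
  fromℤ-+ -[1+ m ] -[1+ n ] = begin
    - (suc (suc (m ℕ.+ n)) · 1#)      ≡⟨ ≡.cong (λ l → - (l · 1#)) (ℕ.+-suc (suc m) n) ⟨
    - ((suc m ℕ.+ suc n) · 1#)        ≈⟨ -‿cong (×-homo-+ 1# (suc m) (suc n)) ⟩
    - (suc m · 1# + suc n · 1#)       ≈⟨ -‿+-comm _ _ ⟨
    - (suc m · 1#) + - (suc n · 1#)   ∎

  fromℤ-neg : ∀ i → fromℤ (ℤ.- i) ≈ - fromℤ i
  fromℤ-neg (+ zero)  = sym -0#≈0#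
  fromℤ-neg (+ suc n) = refl
  fromℤ-neg -[1+ n ]  = sym (-‿involutive _)

  private
    fromℤ-neg◃ : ∀ n → fromℤ (Sign.- ℤ.◃ n) ≈ - (n · 1#)
    fromℤ-neg◃ zero    = sym -0#≈0#
    fromℤ-neg◃ (suc n) = refl

    fromℤ-pos◃ : ∀ n → fromℤ (Sign.+ ℤ.◃ n) ≈ n · 1#
    fromℤ-pos◃ n = reflexive (≡.cong fromℤ (ℤ.+◃n≡+n n))

  fromℤ-* : ∀ i j → fromℤ (i ℤ.* j) ≈ fromℤ i * fromℤ j
  fromℤ-* (+ m)    (+ n)    = trans (fromℤ-pos◃ (m ℕ.* n)) (×1-homo-* m n)
  fromℤ-* (+ m)    -[1+ n ] = begin
    fromℤ (Sign.- ℤ.◃ (m ℕ.* suc n))  ≈⟨ fromℤ-neg◃ (m ℕ.* suc n) ⟩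
    - ((m ℕ.* suc n) · 1#)            ≈⟨ -‿cong (×1-homo-* m (suc n)) ⟩
    - (m · 1# * suc n · 1#)           ≈⟨ -‿distribʳ-* _ _ ⟩
    m · 1# * - (suc n · 1#)           ∎
  fromℤ-* -[1+ m ] (+ n)    = begin
    fromℤ (Sign.- ℤ.◃ (suc m ℕ.* n))  ≈⟨ fromℤ-neg◃ (suc m ℕ.* n) ⟩
    - ((suc m ℕ.* n) · 1#)            ≈⟨ -‿cong (×1-homo-* (suc m) n) ⟩
    - (suc m · 1# * n · 1#)           ≈⟨ -‿distribˡ-* _ _ ⟩
    - (suc m · 1#) * n · 1#           ∎
  fromℤ-* -[1+ m ] -[1+ n ] = begin
    (suc m ℕ.* suc n) · 1#              ≈⟨ ×1-homo-* (suc m) (suc n) ⟩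
    suc m · 1# * suc n · 1#             ≈⟨ -‿involutive _ ⟨
    - - (suc m · 1# * suc n · 1#)       ≈⟨ -‿cong (-‿distribʳ-* _ _) ⟩
    - (suc m · 1# * - (suc n · 1#))     ≈⟨ -‿distribˡ-* _ _ ⟩
    - (suc m · 1#) * - (suc n · 1#)     ∎

  ℤ-morphism : ℤ.+-*-rawRing -Raw-AlmostCommutative⟶ fromCommutativeRing R
  ℤ-morphism = record
    { ⟦_⟧    = fromℤ
    ; +-homo = fromℤ-+
    ; *-homo = fromℤ-*
    ; -‿homo = fromℤ-neg
    ; 0-homo = refl
    ; 1-homo = refl
    }

  fromℤ-≟ : ∀ i j → Maybe (fromℤ i ≈ fromℤ j)
  fromℤ-≟ i j with i ℤ.≟ j
  ... | yes i≡j = just (reflexive (≡.cong fromℤ i≡j))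
  ... | no  _   = nothing

  -- Integer coefficients, because the solver must decide equality of constants, which
  -- does not compute in an abstract ring.
  module Solver = Algebra.Solver.Ring ℤ.+-*-rawRing (fromCommutativeRing R) ℤ-morphism fromℤ-≟

-- Order, arithmetic and finite sums in an ordered field.

module OrderedFieldProperties {c ℓ₁ ℓ₂ : Level} (𝕂 : OrderedField c ℓ₁ ℓ₂) where
  open OrderedField 𝕂 public
    renaming (zero to *-zero)
  open IntegerCoefficients commutativeRing public using (module Solver)
  open Solver public using (solve; _:=_; _:+_; _:*_; _:-_; :-_; con)
  open Algebra.Properties.Semiring.Mult semiring public using ()
    renaming (_×_ to _·_)
  open Algebra.Properties.Semiring.Sum semiring public
  open IsStrictTotalOrder isStrictTotalOrder public
    using (compare; _≟_; _<?_; <-respˡ-≈; <-respʳ-≈)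
    renaming (trans to <-trans; irrefl to <-irrefl)
  open Relation.Binary.Reasoning.Setoid setoid public
  private module ≤ = ToNonStrict _≈_ _<_
  open IsStrictTotalOrder isStrictTotalOrder using (<-resp-≈)

  ≤-refl : ∀ {x} → x ≤ x
  ≤-refl = inj₂ refl

  ≤-trans : ∀ {x y z} → x ≤ y → y ≤ z → x ≤ z
  ≤-trans = ≤.trans isEquivalence <-resp-≈ <-trans

  ≤-antisym : ∀ {x y} → x ≤ y → y ≤ x → x ≈ y
  ≤-antisym = ≤.antisym isEquivalence <-trans <-irrefl

  <-≤-trans : ∀ {x y z} → x < y → y ≤ z → x < z
  <-≤-trans = ≤.<-≤-trans <-trans <-respʳ-≈

  ≤-<-trans : ∀ {x y z} → x ≤ y → y < z → x < z
  ≤-<-trans = ≤.≤-<-trans sym <-trans <-respˡ-≈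

  ≤-respˡ-≈ : ∀ {x y z} → x ≈ y → x ≤ z → y ≤ z
  ≤-respˡ-≈ x≈y x≤z = ≤-trans (inj₂ (sym x≈y)) x≤z

  ≤-respʳ-≈ : ∀ {x y z} → x ≈ y → z ≤ x → z ≤ y
  ≤-respʳ-≈ x≈y z≤x = ≤-trans z≤x (inj₂ x≈y)

  <⇒≱ : ∀ {x y} → x < y → ¬ (y ≤ x)
  <⇒≱ x<y y≤x = <-irrefl refl (<-≤-trans x<y y≤x)

  <⇒≉ : ∀ {x y} → x < y → ¬ (x ≈ y)
  <⇒≉ x<y x≈y = <-irrefl x≈y x<y

  0<⇒≉0 : ∀ {x} → 0# < x → ¬ (x ≈ 0#)
  0<⇒≉0 0<x x≈0 = <-irrefl (sym x≈0) 0<x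

  +-monoʳ-< : ∀ {x y} z → x < y → z + x < z + y
  +-monoʳ-< z x<y = <-respˡ-≈ (+-comm _ z) (<-respʳ-≈ (+-comm _ z) (+-monoˡ-< z x<y))

  +-monoˡ-≤ : ∀ {x y} z → x ≤ y → x + z ≤ y + z
  +-monoˡ-≤ z (inj₁ x<y) = inj₁ (+-monoˡ-< z x<y)
  +-monoˡ-≤ z (inj₂ x≈y) = inj₂ (+-congʳ x≈y)

  +-monoʳ-≤ : ∀ {x y} z → x ≤ y → z + x ≤ z + y
  +-monoʳ-≤ z (inj₁ x<y) = inj₁ (+-monoʳ-< z x<y)
  +-monoʳ-≤ z (inj₂ x≈y) = inj₂ (+-congˡ x≈y)

  +-mono-≤ : ∀ {x y u v} → x ≤ y → u ≤ v → x + u ≤ y + v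
  +-mono-≤ x≤y u≤v = ≤-trans (+-monoˡ-≤ _ x≤y) (+-monoʳ-≤ _ u≤v)

  +-mono-<-≤ : ∀ {x y u v} → x < y → u ≤ v → x + u < y + v
  +-mono-<-≤ x<y u≤v = <-≤-trans (+-monoˡ-< _ x<y) (+-monoʳ-≤ _ u≤v)

  x<y⇒0<y-x : ∀ {x y} → x < y → 0# < y - x
  x<y⇒0<y-x {x} x<y = <-respˡ-≈ (-‿inverseʳ x) (+-monoˡ-< (- x) x<y)

  0<y-x⇒x<y : ∀ {x y} → 0# < y - x → x < y
  0<y-x⇒x<y {x} {y} p = <-respˡ-≈ (+-identityˡ x)
    (<-respʳ-≈ (solve 2 (λ x y → (y :- x) :+ x := y) refl x y) (+-monoˡ-< x p))

  x≤y⇒0≤y-x : ∀ {x y} → x ≤ y → 0# ≤ y - x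
  x≤y⇒0≤y-x {x} (inj₁ p) = inj₁ (x<y⇒0<y-x p)
  x≤y⇒0≤y-x {x} (inj₂ p) = inj₂ (sym (trans (+-congʳ (sym p)) (-‿inverseʳ x)))

  0≤y-x⇒x≤y : ∀ {x y} → 0# ≤ y - x → x ≤ y
  0≤y-x⇒x≤y {x} {y} p = ≤-respˡ-≈ (+-identityˡ x)
    (≤-respʳ-≈ (solve 2 (λ x y → (y :- x) :+ x := y) refl x y) (+-monoˡ-≤ x p))

  x-y≈0⇒x≈y : ∀ {x y} → x - y ≈ 0# → x ≈ y
  x-y≈0⇒x≈y {x} {y} p = begin
    x            ≈⟨ solve 2 (λ x y → x := (x :- y) :+ y) refl x y ⟩
    (x - y) + y  ≈⟨ +-congʳ p ⟩
    0# + y       ≈⟨ +-identityˡ y ⟩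
    y            ∎

  x≈y⇒x-y≈0 : ∀ {x y} → x ≈ y → x - y ≈ 0#
  x≈y⇒x-y≈0 {x} {y} p = trans (+-congʳ p) (-‿inverseʳ y)

  x<0⇒0<-x : ∀ {x} → x < 0# → 0# < - x
  x<0⇒0<-x p = <-respʳ-≈ (+-identityˡ _) (x<y⇒0<y-x p)

  +-nonneg : ∀ {x y} → 0# ≤ x → 0# ≤ y → 0# ≤ x + y
  +-nonneg p q = ≤-respˡ-≈ (+-identityˡ 0#) (+-mono-≤ p q)

  +-pos-nonneg : ∀ {x y} → 0# < x → 0# ≤ y → 0# < x + y
  +-pos-nonneg p q = <-respˡ-≈ (+-identityˡ 0#) (+-mono-<-≤ p q)

  *-nonneg : ∀ {x y} → 0# ≤ x → 0# ≤ y → 0# ≤ x * y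
  *-nonneg (inj₁ p) (inj₁ q) = inj₁ (*-pos p q)
  *-nonneg (inj₂ p) q        = inj₂ (sym (trans (*-congʳ (sym p)) (zeroˡ _)))
  *-nonneg (inj₁ _) (inj₂ q) = inj₂ (sym (trans (*-congˡ (sym q)) (zeroʳ _)))

  *-monoʳ-< : ∀ {x y z} → 0# < z → x < y → z * x < z * y
  *-monoʳ-< {x} {y} {z} 0<z x<y = 0<y-x⇒x<y (<-respʳ-≈
    (solve 3 (λ x y z → z :* (y :- x) := z :* y :- z :* x) refl x y z)
    (*-pos 0<z (x<y⇒0<y-x x<y)))

  *-monoʳ-≤ : ∀ {x y z} → 0# ≤ z → x ≤ y → z * x ≤ z * y
  *-monoʳ-≤ {x} {y} {z} 0≤z x≤y = 0≤y-x⇒x≤y (≤-respʳ-≈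
    (solve 3 (λ x y z → z :* (y :- x) := z :* y :- z :* x) refl x y z)
    (*-nonneg 0≤z (x≤y⇒0≤y-x x≤y)))

  0≤1 : 0# ≤ 1#
  0≤1 = inj₁ 0<1

  1≉0 : ¬ (1# ≈ 0#)
  1≉0 = 0<⇒≉0 0<1

  *-zero-cancelˡ : ∀ {x y} → ¬ (x ≈ 0#) → x * y ≈ 0# → y ≈ 0#
  *-zero-cancelˡ {x} {y} x≉0 xy≈0 = begin
    y                ≈⟨ *-identityˡ y ⟨
    1# * y           ≈⟨ *-congʳ (*-inverseʳ x≉0) ⟨
    (x * x ⁻¹) * y   ≈⟨ solve 3 (λ x x′ y → (x :* x′) :* y := x′ :* (x :* y)) refl x (x ⁻¹) y ⟩
    x ⁻¹ * (x * y)   ≈⟨ *-congˡ xy≈0 ⟩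
    x ⁻¹ * 0#        ≈⟨ zeroʳ _ ⟩
    0#               ∎

  *-cancelˡ : ∀ {x y z} → ¬ (x ≈ 0#) → x * y ≈ x * z → y ≈ z
  *-cancelˡ {x} {y} {z} x≉0 p = x-y≈0⇒x≈y (*-zero-cancelˡ x≉0 (trans
    (solve 3 (λ x y z → x :* (y :- z) := x :* y :- x :* z) refl x y z) (x≈y⇒x-y≈0 p)))

  0<xy⇒0<y : ∀ {x y} → 0# < x → 0# < x * y → 0# < y
  0<xy⇒0<y {x} {y} 0<x 0<xy with compare 0# y
  ... | tri< p _ _ = p
  ... | tri≈ _ p _ = ⊥-elim (<-irrefl (sym (trans (*-congˡ (sym p)) (zeroʳ x))) 0<xy)
  ... | tri> _ _ p = ⊥-elim (<-irrefl refl (<-trans 0<xy (<-respʳ-≈ (zeroʳ x) (*-monoʳ-< 0<x p))))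

  0≤xy⇒0≤y : ∀ {x y} → 0# < x → 0# ≤ x * y → 0# ≤ y
  0≤xy⇒0≤y 0<x (inj₁ p) = inj₁ (0<xy⇒0<y 0<x p)
  0≤xy⇒0≤y 0<x (inj₂ p) = inj₂ (sym (*-zero-cancelˡ (0<⇒≉0 0<x) (sym p)))

  ⁻¹-pos : ∀ {x} → 0# < x → 0# < x ⁻¹
  ⁻¹-pos {x} 0<x = 0<xy⇒0<y 0<x (<-respʳ-≈ (sym (*-inverseʳ (0<⇒≉0 0<x))) 0<1)

  x*[x⁻¹*y]≈y : ∀ {x} y → ¬ (x ≈ 0#) → x * (x ⁻¹ * y) ≈ y
  x*[x⁻¹*y]≈y {x} y x≉0 =
    trans (sym (*-assoc _ _ _)) (trans (*-congʳ (*-inverseʳ x≉0)) (*-identityˡ y))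

  0≤n·1 : ∀ n → 0# ≤ n · 1#
  0≤n·1 zero    = ≤-refl
  0≤n·1 (suc n) = +-nonneg 0≤1 (0≤n·1 n)

  0<1+n·1 : ∀ n → 0# < suc n · 1#
  0<1+n·1 n = +-pos-nonneg 0<1 (0≤n·1 n)

  ∃-min : ∀ {x y} → 0# < x → 0# < y → ∃[ ε ] 0# < ε × ε ≤ x × ε ≤ y
  ∃-min {x} {y} 0<x 0<y with compare x y
  ... | tri< p _ _ = x , 0<x , ≤-refl , inj₁ p
  ... | tri≈ _ p _ = x , 0<x , ≤-refl , inj₂ p
  ... | tri> _ _ p = y , 0<y , inj₁ p , ≤-refl

  ∃-half : ∀ {x} → 0# < x → ∃[ y ] 0# < y × y + y ≈ x
  ∃-half {x} 0<x = (1# + 1#) ⁻¹ * x , *-pos (⁻¹-pos 0<2) 0<x , trans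
    (solve 1 (λ y → y :+ y := (con (+ 1) :+ con (+ 1)) :* y) refl _)
    (x*[x⁻¹*y]≈y x (0<⇒≉0 0<2))
    where
    0<2 : 0# < 1# + 1#
    0<2 = +-pos-nonneg 0<1 0≤1

  sum-zero : ∀ {n} {f : Fin n → Carrier} → (∀ i → f i ≈ 0#) → sum f ≈ 0#
  sum-zero {n} f≈0 = trans (sum-cong-≋ f≈0) (sum-replicate-zero n)

  sum-neg : ∀ {n} (f : Fin n → Carrier) → sum (λ i → - f i) ≈ - sum f
  sum-neg {zero}  f = solve 0 (con (+ 0) := :- con (+ 0)) refl
  sum-neg {suc n} f = trans (+-congˡ (sum-neg (λ i → f (suc i))))
    (solve 2 (λ x y → :- x :+ :- y := :- (x :+ y)) refl _ _)

  sum-sub : ∀ {n} (f g : Fin n → Carrier) → sum (λ i → f i - g i) ≈ sum f - sum g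
  sum-sub f g = trans (∑-distrib-+ f (λ i → - g i)) (+-congˡ (sum-neg g))

  sum-mono : ∀ {n} {f g : Fin n → Carrier} → (∀ i → f i ≤ g i) → sum f ≤ sum g
  sum-mono {zero}  f≤g = ≤-refl
  sum-mono {suc n} f≤g = +-mono-≤ (f≤g zero) (sum-mono (λ i → f≤g (suc i)))

  sum-nonneg : ∀ {n} {f : Fin n → Carrier} → (∀ i → 0# ≤ f i) → 0# ≤ sum f
  sum-nonneg {n} 0≤f = ≤-respˡ-≈ (sum-replicate-zero n) (sum-mono 0≤f)

  term≤sum : ∀ {n} {f : Fin n → Carrier} → (∀ i → 0# ≤ f i) → ∀ i → f i ≤ sum f
  term≤sum 0≤f zero    = ≤-respˡ-≈ (+-identityʳ _) (+-monoʳ-≤ _ (sum-nonneg (λ i → 0≤f (suc i))))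
  term≤sum 0≤f (suc i) = ≤-trans (term≤sum (λ j → 0≤f (suc j)) i)
    (≤-respˡ-≈ (+-identityˡ _) (+-monoˡ-≤ _ (0≤f zero)))

  sum-pos : ∀ {n} {f : Fin n → Carrier} → (∀ i → 0# ≤ f i) → ∀ i → 0# < f i → 0# < sum f
  sum-pos 0≤f i 0<fi = <-≤-trans 0<fi (term≤sum 0≤f i)

  sum≈0⇒term≈0 : ∀ {n} {f : Fin n → Carrier} → (∀ i → 0# ≤ f i) → sum f ≈ 0# → ∀ i → f i ≈ 0#
  sum≈0⇒term≈0 0≤f ∑≈0 i = sym (≤-antisym (0≤f i) (≤-respʳ-≈ ∑≈0 (term≤sum 0≤f i)))

  sum-1 : ∀ n → sum {n} (λ _ → 1#) ≈ n · 1#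
  sum-1 n = sum-replicate n

  ∑-*ˡ : ∀ {n} x (f : Fin n → Carrier) → sum (λ i → x * f i) ≈ x * sum f
  ∑-*ˡ x f = sym (*-distribˡ-sum x f)

  ∑-*ʳ : ∀ {n} x (f : Fin n → Carrier) → sum (λ i → f i * x) ≈ sum f * x
  ∑-*ʳ x f = sym (*-distribʳ-sum x f)

  sum-const : ∀ n x → sum {n} (λ _ → x) ≈ n · 1# * x
  sum-const n x = begin
    sum {n} (λ _ → x)       ≈⟨ sum-cong-≋ {n} (λ _ → sym (*-identityˡ x)) ⟩
    sum {n} (λ _ → 1# * x)  ≈⟨ ∑-*ʳ {n} x (λ _ → 1#) ⟩
    sum {n} (λ _ → 1#) * x  ≈⟨ *-congʳ (sum-1 n) ⟩
    n · 1# * x              ∎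

  -- Recursive in both indices, like `below`, so that sums against it unfold together with `sum`.
  δ : ∀ {n} → Fin n → Fin n → Carrier
  δ zero    zero    = 1#
  δ zero    (suc j) = 0#
  δ (suc i) zero    = 0#
  δ (suc i) (suc j) = δ i j

  δ-refl : ∀ {n} (i : Fin n) → δ i i ≡ 1#
  δ-refl zero    = ≡.refl
  δ-refl (suc i) = δ-refl i

  δ-≢ : ∀ {n} {i j : Fin n} → i ≢ j → δ i j ≡ 0#
  δ-≢ {i = zero}  {zero}  i≢j = ⊥-elim (i≢j ≡.refl)
  δ-≢ {i = zero}  {suc j} i≢j = ≡.refl
  δ-≢ {i = suc i} {zero}  i≢j = ≡.refl
  δ-≢ {i = suc i} {suc j} i≢j = δ-≢ (λ p → i≢j (≡.cong suc p))

  δ-sym : ∀ {n} (i j : Fin n) → δ i j ≡ δ j i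
  δ-sym zero    zero    = ≡.refl
  δ-sym zero    (suc j) = ≡.refl
  δ-sym (suc i) zero    = ≡.refl
  δ-sym (suc i) (suc j) = δ-sym i j

  0≤δ : ∀ {n} (i j : Fin n) → 0# ≤ δ i j
  0≤δ zero    zero    = 0≤1
  0≤δ zero    (suc j) = ≤-refl
  0≤δ (suc i) zero    = ≤-refl
  0≤δ (suc i) (suc j) = 0≤δ i j

  sum-δ : ∀ {n} (i : Fin n) (f : Fin n → Carrier) → sum (λ j → δ i j * f j) ≈ f i
  sum-δ zero    f = trans (+-cong (*-identityˡ _) (sum-zero (λ j → zeroˡ (f (suc j))))) (+-identityʳ _)
  sum-δ (suc i) f = trans (+-cong (zeroˡ _) (sum-δ i (λ j → f (suc j)))) (+-identityˡ _)

  sum-δ₁ : ∀ {n} (i : Fin n) → sum (δ i) ≈ 1#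
  sum-δ₁ i = trans (sum-cong-≋ (λ j → sym (*-identityʳ (δ i j)))) (sum-δ i (λ _ → 1#))

  below : ∀ {n} → Fin n → Fin n → Carrier
  below zero    j       = 0#
  below (suc i) zero    = 1#
  below (suc i) (suc j) = below i j

  below-< : ∀ {n} {i j : Fin n} → j Fin.< i → below i j ≡ 1#
  below-< {i = zero}  ()
  below-< {i = suc i} {zero}  p       = ≡.refl
  below-< {i = suc i} {suc j} (s≤s p) = below-< p

  below-≮ : ∀ {n} {i j : Fin n} → ¬ (j Fin.< i) → below i j ≡ 0#
  below-≮ {i = zero}          p = ≡.refl
  below-≮ {i = suc i} {zero}  p = ⊥-elim (p (s≤s z≤n))
  below-≮ {i = suc i} {suc j} p = below-≮ (λ q → p (s≤s q))

  0≤below : ∀ {n} (i j : Fin n) → 0# ≤ below i j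
  0≤below zero    j       = ≤-refl
  0≤below (suc i) zero    = 0≤1
  0≤below (suc i) (suc j) = 0≤below i j

  prefix : ∀ {n} → Fin n → (Fin n → Carrier) → Carrier
  prefix i f = sum (λ j → below i j * f j)

  prefix-zero : ∀ {n} (f : Fin (suc n) → Carrier) → prefix zero f ≈ 0#
  prefix-zero f = sum-zero (λ j → zeroˡ (f j))

  prefix-suc : ∀ {n} (i : Fin n) (f : Fin (suc n) → Carrier) →
    prefix (suc i) f ≈ f zero + prefix i (λ j → f (suc j))
  prefix-suc i f = +-congʳ (*-identityˡ _)

  sum-below : ∀ {n} (i : Fin n) → sum (below i) ≈ toℕ i · 1#
  sum-below {suc n} zero    = sum-replicate-zero (suc n)
  sum-below {suc n} (suc i) = +-congˡ (sum-below i)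

  prefix-cong : ∀ {n} (i : Fin n) {f g : Fin n → Carrier} →
    (∀ j → j Fin.< i → f j ≈ g j) → prefix i f ≈ prefix i g
  prefix-cong i {f} {g} p = sum-cong-≋ λ j → lem j
    where
    lem : ∀ j → below i j * f j ≈ below i j * g j
    lem j with j Fin.<? i
    ... | yes q = *-congˡ (p j q)
    ... | no  q rewrite below-≮ q = trans (zeroˡ _) (sym (zeroˡ _))

-- Boolean subsets of the vertices and their enumeration.

true≢false : true ≢ false
true≢false ()

bool-cases : ∀ {p} {P : Set p} (u : Bool) → (u ≡ true → P) → (u ≡ false → P) → P
bool-cases true  on off = on ≡.refl
bool-cases false on off = off ≡.refl

⌊⌋-true : ∀ {p} {P : Set p} (P? : Dec P) → P → ⌊ P? ⌋ ≡ true
⌊⌋-true (yes _) _ = ≡.refl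
⌊⌋-true (no ¬p) p = ⊥-elim (¬p p)

⌊⌋-false : ∀ {p} {P : Set p} (P? : Dec P) → ¬ P → ⌊ P? ⌋ ≡ false
⌊⌋-false (yes p) ¬p = ⊥-elim (¬p p)
⌊⌋-false (no _)  _  = ≡.refl

true-⌊⌋ : ∀ {p} {P : Set p} (P? : Dec P) → ⌊ P? ⌋ ≡ true → P
true-⌊⌋ (yes p) _ = p

false-⌊⌋ : ∀ {p} {P : Set p} (P? : Dec P) → ⌊ P? ⌋ ≡ false → ¬ P
false-⌊⌋ (no ¬p) _ = ¬p

∨-false : ∀ {a b} → a ∨ b ≡ false → a ≡ false × b ≡ false
∨-false {false} p = ≡.refl , p

∧-true : ∀ {a b} → a ∧ b ≡ true → a ≡ true × b ≡ true
∧-true {true} p = ≡.refl , p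

isFirst : ∀ {n} → Fin n → Bool
isFirst v = toℕ v ℕ.≡ᵇ 0

≡0⇒isFirst : ∀ {n} (v : Fin n) → toℕ v ≡ 0 → isFirst v ≡ true
≡0⇒isFirst v v≡0 = ≡.cong (ℕ._≡ᵇ 0) v≡0

isFirst⇒≡0 : ∀ {n} (v : Fin n) → isFirst v ≡ true → toℕ v ≡ 0
isFirst⇒≡0 zero _ = ≡.refl

¬isFirst⇒1≤ : ∀ {n} (v : Fin n) → isFirst v ≡ false → 1 ℕ.≤ toℕ v
¬isFirst⇒1≤ (suc v) _ = s≤s z≤n

1≤⇒¬isFirst : ∀ {n} (v : Fin n) → 1 ℕ.≤ toℕ v → isFirst v ≡ false
1≤⇒¬isFirst (suc v) _ = ≡.refl

count : ∀ {n} → (Fin n → Bool) → ℕ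
count {zero}  U = zero
count {suc n} U = if U zero then suc (count (U ∘ suc)) else count (U ∘ suc)

count-cong : ∀ {n} {U U′ : Fin n → Bool} → (∀ v → U v ≡ U′ v) → count U ≡ count U′
count-cong {zero}  p = ≡.refl
count-cong {suc n} {U} {U′} p rewrite p zero | count-cong (λ v → p (suc v)) = ≡.refl

count-inside : ∀ {n} (U : Fin (suc n) → Bool) → U zero ≡ true → count U ≡ suc (count (U ∘ suc))
count-inside U p rewrite p = ≡.refl

count-outside : ∀ {n} (U : Fin (suc n) → Bool) → U zero ≡ false → count U ≡ count (U ∘ suc)
count-outside U p rewrite p = ≡.refl

count-suc : ∀ {n} (U : Fin n → Bool) v → U v ≡ true → ∃[ m ] count U ≡ suc m
count-suc {suc n} U zero    p = _ , count-inside U p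
count-suc {suc n} U (suc v) p with U zero
... | true  = _ , ≡.refl
... | false = count-suc (U ∘ suc) v p

count-first : ∀ {n} (H : Fin n → Bool) → Fin n → (∀ v → toℕ v ≡ 0 → H v ≡ false) →
  count (λ v → isFirst v ∨ H v) ≡ suc (count H)
count-first {suc n} H _ H-first = ≡.cong suc (≡.sym (count-outside H (H-first zero ≡.refl)))

index : ∀ {n} (U : Fin n → Bool) → Fin (count U) → Fin n
index {suc n} U r with U zero
index {suc n} U zero    | true  = zero
index {suc n} U (suc r) | true  = suc (index (U ∘ suc) r)
index {suc n} U r       | false = suc (index (U ∘ suc) r)

index-∈ : ∀ {n} (U : Fin n → Bool) r → U (index U r) ≡ true
index-∈ {suc n} U r with U zero in eq
index-∈ {suc n} U zero    | true  = eq
index-∈ {suc n} U (suc r) | true  = index-∈ (U ∘ suc) r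
index-∈ {suc n} U r       | false = index-∈ (U ∘ suc) r

-- Functions that average their earlier values, and barycentric coordinates.

module WeightedSums {c ℓ₁ ℓ₂ : Level} (𝕂 : OrderedField c ℓ₁ ℓ₂) where
  open OrderedFieldProperties 𝕂

  Supported : ∀ {n} → (Fin n → Bool) → (Fin n → Carrier) → Set ℓ₁
  Supported U w = ∀ v → U v ≡ false → w v ≈ 0#

  -- Translates between weights on the members of `U` alone, which affine independence and `conv`
  -- ask for, and weights on all vertices, where different subsets can be compared.
  extendByZero : ∀ {n} (U : Fin n → Bool) → (Fin (count U) → Carrier) → Fin n → Carrier
  extendByZero {suc n} U w v with U zero
  extendByZero {suc n} U w zero    | true  = w zero
  extendByZero {suc n} U w (suc v) | true  = extendByZero (U ∘ suc) (w ∘ suc) v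
  extendByZero {suc n} U w zero    | false = 0#
  extendByZero {suc n} U w (suc v) | false = extendByZero (U ∘ suc) w v

  extendByZero-supported : ∀ {n} (U : Fin n → Bool) w → Supported U (extendByZero U w)
  extendByZero-supported {suc n} U w v p with U zero in eq
  extendByZero-supported {suc n} U w zero    p | true  with () ← ≡.trans (≡.sym eq) p
  extendByZero-supported {suc n} U w (suc v) p | true  = extendByZero-supported (U ∘ suc) (w ∘ suc) v p
  extendByZero-supported {suc n} U w zero    p | false = refl
  extendByZero-supported {suc n} U w (suc v) p | false = extendByZero-supported (U ∘ suc) w v p

  extendByZero-index : ∀ {n} (U : Fin n → Bool) w r → extendByZero U w (index U r) ≡ w r
  extendByZero-index {suc n} U w r with U zero
  extendByZero-index {suc n} U w zero    | true  = ≡.refl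
  extendByZero-index {suc n} U w (suc r) | true  = extendByZero-index (U ∘ suc) (w ∘ suc) r
  extendByZero-index {suc n} U w r       | false = extendByZero-index (U ∘ suc) w r

  sum-index : ∀ {n} (U : Fin n → Bool) f → Supported U f → sum (λ r → f (index U r)) ≈ sum f
  sum-index {zero}  U f f-supp = refl
  sum-index {suc n} U f f-supp with U zero in eq
  ... | true  = +-congˡ (sum-index (U ∘ suc) (f ∘ suc) (λ v → f-supp (suc v)))
  ... | false = trans (sum-index (U ∘ suc) (f ∘ suc) (λ v → f-supp (suc v)))
                      (trans (sym (+-identityˡ _)) (+-congʳ (sym (f-supp zero eq))))

  sum-extendByZero : ∀ {n} (U : Fin n → Bool) (w : Fin (count U) → Carrier) (h : Fin n → Carrier) →
    sum (λ r → w r * h (index U r)) ≈ sum (λ v → extendByZero U w v * h v)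
  sum-extendByZero U w h = begin
    sum (λ r → w r * h (index U r))
      ≈⟨ sum-cong-≋ (λ r → *-congʳ {h (index U r)} (reflexive (extendByZero-index U w r))) ⟨
    sum (λ r → extendByZero U w (index U r) * h (index U r))
      ≈⟨ sum-index U (λ v → extendByZero U w v * h v)
           (λ v p → trans (*-congʳ (extendByZero-supported U w v p)) (zeroˡ (h v))) ⟩
    sum (λ v → extendByZero U w v * h v) ∎

  sum-extendByZero₁ : ∀ {n} (U : Fin n → Bool) (w : Fin (count U) → Carrier) → sum w ≈ sum (extendByZero U w)
  sum-extendByZero₁ U w = begin
    sum w
      ≈⟨ sum-cong-≋ (λ r → reflexive (extendByZero-index U w r)) ⟨
    sum (λ r → extendByZero U w (index U r))
      ≈⟨ sum-index U (extendByZero U w) (extendByZero-supported U w) ⟩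
    sum (extendByZero U w) ∎

  prefix-linear : ∀ {m n} (i : Fin n) (w : Fin m → Carrier) (φ : Fin m → Fin n → Carrier) →
    prefix i (λ j → sum (λ q → w q * φ q j)) ≈ sum (λ q → w q * prefix i (φ q))
  prefix-linear i w φ = begin
    sum (λ j → below i j * sum (λ q → w q * φ q j))
      ≈⟨ sum-cong-≋ (λ j → *-distribˡ-sum (below i j) (λ q → w q * φ q j)) ⟩
    sum (λ j → sum (λ q → below i j * (w q * φ q j)))
      ≈⟨ ∑-comm (λ j q → below i j * (w q * φ q j)) ⟩
    sum (λ q → sum (λ j → below i j * (w q * φ q j)))
      ≈⟨ sum-cong-≋ (λ q → sum-cong-≋ (λ j →
           solve 3 (λ x y z → x :* (y :* z) := y :* (x :* z)) refl (below i j) (w q) (φ q j))) ⟩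
    sum (λ q → sum (λ j → w q * (below i j * φ q j)))
      ≈⟨ sum-cong-≋ (λ q → ∑-*ˡ (w q) (λ j → below i j * φ q j)) ⟩
    sum (λ q → w q * prefix i (φ q)) ∎

  prefix-sub : ∀ {n} (i : Fin n) (f g : Fin n → Carrier) →
    prefix i (λ j → f j - g j) ≈ prefix i f - prefix i g
  prefix-sub i f g = trans
    (sum-cong-≋ (λ j → solve 3 (λ x y z → x :* (y :- z) := x :* y :- x :* z) refl (below i j) (f j) (g j)))
    (sum-sub (λ j → below i j * f j) (λ j → below i j * g j))

  prefix-mono : ∀ {n} (i : Fin n) {f : Fin n → Carrier} →
    (∀ j → j Fin.< i → 0# ≤ f j) → ∀ j → 0# ≤ below i j * f j
  prefix-mono i {f} 0≤f j with j Fin.<? i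
  ... | yes p = *-nonneg (0≤below i j) (0≤f j p)
  ... | no  p = inj₂ (sym (trans (*-congʳ (reflexive (below-≮ p))) (zeroˡ _)))

  -- Division-free form of `φ v` being the mean of the `toℕ v` earlier values. At the first vertex
  -- it degenerates to 0 = 0 and leaves the value undetermined.
  AveragesOff : ∀ {n} → (Fin n → Bool) → (Fin n → Carrier) → Set ℓ₁
  AveragesOff V φ = ∀ v → V v ≡ false → toℕ v · 1# * φ v ≈ prefix v φ

  averagesOff-cong : ∀ {n} {V : Fin n → Bool} {φ ψ} → (∀ v → φ v ≈ ψ v) →
    AveragesOff V φ → AveragesOff V ψ
  averagesOff-cong p φ-avg v v∉V = trans (*-congˡ (sym (p v)))
    (trans (φ-avg v v∉V) (sum-cong-≋ (λ j → *-congˡ (p j))))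

  averagesOff-linear : ∀ {m n} {V : Fin n → Bool} (w : Fin m → Carrier) (φ : Fin m → Fin n → Carrier) →
    (∀ q → AveragesOff V (φ q)) → AveragesOff V (λ v → sum (λ q → w q * φ q v))
  averagesOff-linear w φ φ-avg v v∉V = begin
    toℕ v · 1# * sum (λ q → w q * φ q v)
      ≈⟨ *-distribˡ-sum (toℕ v · 1#) (λ q → w q * φ q v) ⟩
    sum (λ q → toℕ v · 1# * (w q * φ q v))
      ≈⟨ sum-cong-≋ (λ q → trans
           (solve 3 (λ x y z → x :* (y :* z) := y :* (x :* z)) refl (toℕ v · 1#) (w q) (φ q v))
           (*-congˡ (φ-avg q v v∉V))) ⟩
    sum (λ q → w q * prefix v (φ q))
      ≈⟨ prefix-linear v w φ ⟨
    prefix v (λ v → sum (λ q → w q * φ q v)) ∎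

  averagesOff-sub : ∀ {n} {V : Fin n → Bool} {φ ψ} →
    AveragesOff V φ → AveragesOff V ψ → AveragesOff V (λ v → φ v - ψ v)
  averagesOff-sub {φ = φ} {ψ} φ-avg ψ-avg v v∉V = trans
    (solve 3 (λ x y z → x :* (y :- z) := x :* y :- x :* z) refl (toℕ v · 1#) (φ v) (ψ v))
    (trans (+-cong (φ-avg v v∉V) (-‿cong (ψ-avg v v∉V))) (sym (prefix-sub v φ ψ)))

  averagesOff-const : ∀ {n} {V : Fin n → Bool} x → AveragesOff V (λ _ → x)
  averagesOff-const x v _ = trans (*-congʳ (sym (sum-below v))) (*-distribʳ-sum x (below v))

  private
    -- Existence of a solution of the averaging rule with values `g` on `V`; the running count and
    -- sum make the recursion structural.
    extend : ∀ {n} → Carrier → Carrier → (Fin n → Bool) → (Fin n → Carrier) → Fin n → Carrier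
    extend m s V g zero    = if V zero then g zero else m ⁻¹ * s
    extend m s V g (suc v) =
      extend (1# + m) (s + (if V zero then g zero else m ⁻¹ * s)) (V ∘ suc) (g ∘ suc) v

    extend-on : ∀ {n} m s (V : Fin n → Bool) g v → V v ≡ true → extend m s V g v ≡ g v
    extend-on m s V g zero    v∈V rewrite v∈V = ≡.refl
    extend-on m s V g (suc v) v∈V = extend-on _ _ (V ∘ suc) (g ∘ suc) v v∈V

    -- m and s count and sum the values preceding the vector under construction.
    extend-averages : ∀ {n} m s (V : Fin n → Bool) g v → V v ≡ false → ¬ (m + toℕ v · 1# ≈ 0#) →
      (m + toℕ v · 1#) * extend m s V g v ≈ s + prefix v (extend m s V g)
    extend-averages m s V g zero v∉V m≉0 = begin
      (m + 0#) * e zero      ≡⟨ ≡.cong (λ b → (m + 0#) * (if b then g zero else m ⁻¹ * s)) v∉V ⟩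
      (m + 0#) * (m ⁻¹ * s)  ≈⟨ *-congʳ (+-identityʳ m) ⟩
      m * (m ⁻¹ * s)         ≈⟨ x*[x⁻¹*y]≈y s (λ p → m≉0 (trans (+-identityʳ m) p)) ⟩
      s                      ≈⟨ +-identityʳ s ⟨
      s + 0#                 ≈⟨ +-congˡ (prefix-zero e) ⟨
      s + prefix zero e      ∎
      where
      e = extend m s V g
    extend-averages m s V g (suc v) v∉V m≉0 = begin
      (m + (1# + toℕ v · 1#)) * e v    ≈⟨ *-congʳ shift ⟩
      ((1# + m) + toℕ v · 1#) * e v
        ≈⟨ extend-averages (1# + m) (s + h) (V ∘ suc) (g ∘ suc) v v∉V (λ p → m≉0 (trans shift p)) ⟩
      (s + h) + prefix v e             ≈⟨ +-assoc s h _ ⟩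
      s + (h + prefix v e)             ≈⟨ +-congˡ (prefix-suc v (extend m s V g)) ⟨
      s + prefix (suc v) (extend m s V g) ∎
      where
      h = if V zero then g zero else m ⁻¹ * s
      e = extend (1# + m) (s + h) (V ∘ suc) (g ∘ suc)
      shift : m + (1# + toℕ v · 1#) ≈ (1# + m) + toℕ v · 1#
      shift = solve 3 (λ x y z → x :+ (y :+ z) := (y :+ x) :+ z) refl m 1# (toℕ v · 1#)

  module Barycentric {n : ℕ} (V : Fin n → Bool) (first∈V : ∀ v → toℕ v ≡ 0 → V v ≡ true) where

    0<outside : ∀ v → V v ≡ false → 0# < toℕ v · 1#
    0<outside v v∉V with toℕ v in eq
    ... | zero with () ← ≡.trans (≡.sym (first∈V v eq)) v∉V
    ... | suc m = 0<1+n·1 m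

    -- Strong induction on the position with the vertices of `V` as base cases: the values on `V`
    -- govern all others.
    outside-induction : ∀ {p} (P : Fin n → Set p) →
      (∀ v → V v ≡ true → P v) →
      (∀ v → V v ≡ false → (∀ j → j Fin.< v → P j) → P v) → ∀ v → P v
    outside-induction P on off v = go (suc (toℕ v)) v (ℕ.n<1+n _)
      where
      go : ∀ m v → toℕ v ℕ.< m → P v
      go (suc m) v (s≤s v≤m) with V v in eq
      ... | true  = on v eq
      ... | false = off v eq (λ j j<v → go m j (ℕ.<-≤-trans j<v v≤m))

    averagesOff-zero : ∀ {φ} → AveragesOff V φ → (∀ v → V v ≡ true → φ v ≈ 0#) → ∀ v → φ v ≈ 0#
    averagesOff-zero {φ} φ-avg on = outside-induction _ on λ v v∉V ih →
      *-zero-cancelˡ (0<⇒≉0 (0<outside v v∉V)) (trans (φ-avg v v∉V)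
        (trans (prefix-cong v {φ} {λ _ → 0#} ih) (sum-zero (λ j → zeroʳ (below v j)))))

    averagesOff-unique : ∀ {φ ψ} → AveragesOff V φ → AveragesOff V ψ →
      (∀ v → V v ≡ true → φ v ≈ ψ v) → ∀ v → φ v ≈ ψ v
    averagesOff-unique φ-avg ψ-avg on v = x-y≈0⇒x≈y
      (averagesOff-zero (averagesOff-sub φ-avg ψ-avg) (λ v v∈V → x≈y⇒x-y≈0 (on v v∈V)) v)

    averagesOff-nonneg : ∀ {φ} → AveragesOff V φ → (∀ v → V v ≡ true → 0# ≤ φ v) → ∀ v → 0# ≤ φ v
    averagesOff-nonneg φ-avg on = outside-induction _ on λ v v∉V ih →
      0≤xy⇒0≤y (0<outside v v∉V) (≤-respʳ-≈ (sym (φ-avg v v∉V)) (sum-nonneg (prefix-mono v ih)))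

    -- An average of nonnegative values, one of them positive, is positive. All strict inequalities
    -- at `i₀` come from here.
    averagesOff-pos : ∀ {φ} → AveragesOff V φ → (∀ v → 0# ≤ φ v) →
      ∀ v → V v ≡ false → ∀ j → j Fin.< v → 0# < φ j → 0# < φ v
    averagesOff-pos {φ} φ-avg 0≤φ v v∉V j j<v 0<φj =
      0<xy⇒0<y (0<outside v v∉V) (<-respʳ-≈ (sym (φ-avg v v∉V))
        (sum-pos (prefix-mono v (λ j _ → 0≤φ j)) j
          (<-respʳ-≈ (trans (sym (*-identityˡ _)) (*-congʳ (reflexive (≡.sym (below-< j<v))))) 0<φj)))

    -- The barycentric coordinate belonging to q; it vanishes identically when q ∉ V.
    bary : Fin n → Fin n → Carrier
    bary q = extend 0# 0# V (δ q)

    bary-on : ∀ q v → V v ≡ true → bary q v ≈ δ q v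
    bary-on q v v∈V = reflexive (extend-on 0# 0# V (δ q) v v∈V)

    bary-averages : ∀ q → AveragesOff V (bary q)
    bary-averages q v v∉V = begin
      toℕ v · 1# * bary q v         ≈⟨ *-congʳ (+-identityˡ _) ⟨
      (0# + toℕ v · 1#) * bary q v  ≈⟨ extend-averages 0# 0# V (δ q) v v∉V
                                         (λ p → 0<⇒≉0 (0<outside v v∉V) (trans (sym (+-identityˡ _)) p)) ⟩
      0# + prefix v (bary q)        ≈⟨ +-identityˡ _ ⟩
      prefix v (bary q)             ∎

    0≤bary : ∀ q v → 0# ≤ bary q v
    0≤bary q = averagesOff-nonneg (bary-averages q) (λ v v∈V → ≤-respʳ-≈ (sym (bary-on q v v∈V)) (0≤δ q v))

    bary-outside : ∀ q v → V q ≡ false → bary q v ≈ 0#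
    bary-outside q v q∉V = averagesOff-zero (bary-averages q) (λ v v∈V →
      trans (bary-on q v v∈V) (reflexive (δ-≢ λ q≡v →
        true≢false (≡.trans (≡.sym v∈V) (≡.trans (≡.cong V (≡.sym q≡v)) q∉V))))) v

    -- Averages look only backwards, so the unit placed at `q` cannot influence earlier vertices.
    bary-before : ∀ q v → v Fin.< q → bary q v ≈ 0#
    bary-before q = outside-induction (λ v → v Fin.< q → bary q v ≈ 0#)
      (λ v v∈V v<q → trans (bary-on q v v∈V) (reflexive (δ-≢ λ q≡v → Fin.<⇒≢ v<q (≡.sym q≡v))))
      (λ v v∉V ih v<q → *-zero-cancelˡ (0<⇒≉0 (0<outside v v∉V)) (trans (bary-averages q v v∉V)
        (trans (prefix-cong v {bary q} {λ _ → 0#} (λ j j<v → ih j j<v (ℕ.<-trans j<v v<q)))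
               (sum-zero (λ j → zeroʳ (below v j))))))

    -- Both sides obey the averaging rule and agree on `V`, where `bary` is a Kronecker delta;
    -- uniqueness does the rest.
    interpolation : ∀ {φ} → AveragesOff V φ → ∀ v → φ v ≈ sum (λ q → bary q v * φ q)
    interpolation {φ} φ-avg = averagesOff-unique φ-avg
      (averagesOff-cong (λ v → sum-cong-≋ (λ q → *-comm (φ q) (bary q v)))
        (averagesOff-linear φ bary bary-averages))
      (λ v v∈V → sym (trans
        (sum-cong-≋ (λ q → *-congʳ (trans (bary-on q v v∈V) (reflexive (δ-sym q v)))))
        (sum-δ v φ)))

    sum-bary : ∀ v → sum (λ q → bary q v) ≈ 1#
    sum-bary v = trans (sum-cong-≋ (λ q → sym (*-identityʳ (bary q v))))
      (sym (interpolation (averagesOff-const 1#) v))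

-- Affine functions on a configuration and neighbourhoods given by boxes.

module ConvexGeometry {c ℓ₁ ℓ₂ : Level} (𝕂 : OrderedField c ℓ₁ ℓ₂) where
  open OrderedFieldProperties 𝕂
  open WeightedSums 𝕂
  open Eigenpolytopes 𝕂 hiding (module Designs)

  ∙-linComb : ∀ {m d} (y : Vec d) (w : Vec m) (p : Vector (Vec d) m) →
    y ∙ linComb w p ≈ sum (λ i → w i * (y ∙ p i))
  ∙-linComb y w p = begin
    sum (λ r → y r * sum (λ i → w i * p i r))
      ≈⟨ sum-cong-≋ (λ r → *-distribˡ-sum (y r) (λ i → w i * p i r)) ⟩
    sum (λ r → sum (λ i → y r * (w i * p i r)))
      ≈⟨ ∑-comm (λ r i → y r * (w i * p i r)) ⟩
    sum (λ i → sum (λ r → y r * (w i * p i r)))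
      ≈⟨ sum-cong-≋ (λ i → sum-cong-≋ (λ r →
           solve 3 (λ x y z → x :* (y :* z) := y :* (x :* z)) refl (y r) (w i) (p i r))) ⟩
    sum (λ i → sum (λ r → w i * (y r * p i r)))
      ≈⟨ sum-cong-≋ (λ i → ∑-*ˡ (w i) (λ r → y r * p i r)) ⟩
    sum (λ i → w i * (y ∙ p i)) ∎

  linComb-linComb : ∀ {l m d} (w : Vec l) (g : Vector (Vec m) l) (p : Vector (Vec d) m) →
    linComb w (λ i → linComb (g i) p) ≋ linComb (linComb w g) p
  linComb-linComb w g p r = begin
    sum (λ i → w i * sum (λ j → g i j * p j r))
      ≈⟨ sum-cong-≋ (λ i → *-distribˡ-sum (w i) (λ j → g i j * p j r)) ⟩
    sum (λ i → sum (λ j → w i * (g i j * p j r)))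
      ≈⟨ ∑-comm (λ i j → w i * (g i j * p j r)) ⟩
    sum (λ j → sum (λ i → w i * (g i j * p j r)))
      ≈⟨ sum-cong-≋ (λ j → trans
           (sum-cong-≋ (λ i → sym (*-assoc (w i) (g i j) (p j r))))
           (∑-*ʳ (p j r) (λ i → w i * g i j))) ⟩
    sum (λ j → sum (λ i → w i * g i j) * p j r) ∎

  sum-linComb : ∀ {l m} (w : Vec l) (g : Vector (Vec m) l) → (∀ i → sum (g i) ≈ 1#) →
    sum (linComb w g) ≈ sum w
  sum-linComb w g ∑g≈1 = begin
    sum (λ j → sum (λ i → w i * g i j))  ≈⟨ ∑-comm (λ j i → w i * g i j) ⟩
    sum (λ i → sum (λ j → w i * g i j))  ≈⟨ sum-cong-≋ (λ i → trans (∑-*ˡ (w i) (g i))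
                                              (trans (*-congˡ (∑g≈1 i)) (*-identityʳ (w i)))) ⟩
    sum w ∎

  linComb-congʳ : ∀ {m d} (w : Vec m) {p q : Vector (Vec d) m} → (∀ i → p i ≋ q i) →
    linComb w p ≋ linComb w q
  linComb-congʳ w p≋q r = sum-cong-≋ (λ i → *-congˡ (p≋q i r))

  linComb-δ : ∀ {m d} (i : Fin m) (p : Vector (Vec d) m) → linComb (δ i) p ≋ p i
  linComb-δ i p r = sum-δ i (λ j → p j r)

  ∙-congʳ : ∀ {d} (y : Vec d) {x x′} → x ≋ x′ → y ∙ x ≈ y ∙ x′
  ∙-congʳ y x≋x′ = sum-cong-≋ (λ r → *-congˡ (x≋x′ r))

  ∙-zeroʳ : ∀ {d} (y : Vec d) → y ∙ 𝟎 ≈ 0#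
  ∙-zeroʳ y = sum-zero (λ r → zeroʳ (y r))

  ∙-sub : ∀ {d} (y x x′ : Vec d) → y ∙ (λ r → x r - x′ r) ≈ y ∙ x - y ∙ x′
  ∙-sub y x x′ = trans
    (sum-cong-≋ (λ r → solve 3 (λ y x x′ → y :* (x :- x′) := y :* x :- y :* x′) refl (y r) (x r) (x′ r)))
    (sum-sub (λ r → y r * x r) (λ r → y r * x′ r))

  ∙-comm : ∀ {d} (x y : Vec d) → x ∙ y ≈ y ∙ x
  ∙-comm x y = sum-cong-≋ (λ r → *-comm (x r) (y r))

  lower-bound : ∀ {n} (f : Vec n) → (∀ i → 0# < f i) → ∃[ ε ] 0# < ε × (∀ i → ε ≤ f i)
  lower-bound {zero}  f 0<f = 1# , 0<1 , λ ()
  lower-bound {suc n} f 0<f =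
    let ε₁ , 0<ε₁ , ε₁≤f = lower-bound (f ∘ suc) (0<f ∘ suc)
        ε , 0<ε , ε≤f₀ , ε≤ε₁ = ∃-min (0<f zero) 0<ε₁
    in ε , 0<ε , λ { zero → ε≤f₀ ; (suc i) → ≤-trans ε≤ε₁ (ε₁≤f i) }

  private
    -- The bound `a` is the absolute value of `x`, obtained by deciding its sign.
    product-bound : ∀ x → ∃[ a ] 0# ≤ a × (∀ z ε → z < ε → - z < ε → x * z ≤ a * ε)
    product-bound x with compare 0# x
    ... | tri< 0<x _ _ = x , inj₁ 0<x , λ z ε z<ε _ → inj₁ (*-monoʳ-< 0<x z<ε)
    ... | tri≈ _ 0≈x _ = 0# , ≤-refl , λ z ε _ _ →
      inj₂ (trans (*-congʳ (sym 0≈x)) (trans (zeroˡ z) (sym (zeroˡ ε))))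
    ... | tri> _ _ x<0 = - x , inj₁ (x<0⇒0<-x x<0) , λ z ε _ -z<ε →
      ≤-respˡ-≈ (solve 2 (λ x z → :- x :* :- z := x :* z) refl x z)
        (inj₁ (*-monoʳ-< (x<0⇒0<-x x<0) -z<ε))

    -- Here `a` is 1 plus the sum of the absolute values; the 1 keeps it positive, hence invertible,
    -- even for the zero vector.
    sup-bound : ∀ {d} (z : Vec d) → ∃[ a ] 0# < a × (∀ r → z r ≤ a × - z r ≤ a)
    sup-bound {zero}  z = 1# , 0<1 , λ ()
    sup-bound {suc d} z with sup-bound (z ∘ suc) | compare 0# (z zero)
    ... | a , 0<a , p | tri< 0<z _ _ = a + z zero , +-pos-nonneg 0<a (inj₁ 0<z) , λ
      { zero    → ≤-respˡ-≈ (+-identityˡ _) (+-monoˡ-≤ _ (inj₁ 0<a))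
                , ≤-trans (inj₁ (0<y-x⇒x<y (<-respʳ-≈ (solve 1 (λ z → z :+ z := z :- :- z) refl (z zero))
                    (+-pos-nonneg 0<z (inj₁ 0<z)))))
                    (≤-respˡ-≈ (+-identityˡ _) (+-monoˡ-≤ _ (inj₁ 0<a)))
      ; (suc r) → ≤-trans (proj₁ (p r)) a≤a+z , ≤-trans (proj₂ (p r)) a≤a+z }
      where
      a≤a+z : a ≤ a + z zero
      a≤a+z = ≤-respˡ-≈ (+-identityʳ a) (+-monoʳ-≤ a (inj₁ 0<z))
    ... | a , 0<a , p | tri≈ _ 0≈z _ = a , 0<a , λ
      { zero    → ≤-trans (inj₂ (sym 0≈z)) (inj₁ 0<a)
                , ≤-trans (inj₂ (trans (-‿cong (sym 0≈z)) (solve 0 (:- con (+ 0) := con (+ 0)) refl))) (inj₁ 0<a)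
      ; (suc r) → p r }
    ... | a , 0<a , p | tri> _ _ z<0 = a - z zero , +-pos-nonneg 0<a (inj₁ 0<-z) , λ
      { zero    → ≤-trans (inj₁ (<-trans z<0 0<-z)) -z≤a-z , -z≤a-z
      ; (suc r) → ≤-trans (proj₁ (p r)) a≤a-z , ≤-trans (proj₂ (p r)) a≤a-z }
      where
      0<-z = x<0⇒0<-x z<0
      -z≤a-z : - z zero ≤ a - z zero
      -z≤a-z = ≤-respˡ-≈ (+-identityˡ _) (+-monoˡ-≤ _ (inj₁ 0<a))
      a≤a-z : a ≤ a - z zero
      a≤a-z = ≤-respˡ-≈ (+-identityʳ a) (+-monoʳ-≤ a (inj₁ 0<-z))

  functional-continuous : ∀ {d} (y : Vec d) {η} → 0# < η →
    ∃[ ε ] 0# < ε × (∀ z → (∀ r → z r < ε × - z r < ε) → y ∙ z < η)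
  functional-continuous y {η} 0<η = ε , *-pos (⁻¹-pos 0<a) 0<η , λ z z<ε →
    ≤-<-trans
      (≤-respʳ-≈ (∑-*ʳ ε (λ r → proj₁ (product-bound (y r))))
        (sum-mono (λ r → proj₂ (proj₂ (product-bound (y r))) (z r) ε (proj₁ (z<ε r)) (proj₂ (z<ε r)))))
      (<-respʳ-≈ (trans (solve 3 (λ a ε o → ε :* a :+ ε :* o := (o :+ a) :* ε) refl (sum A) ε 1#)
                        (x*[x⁻¹*y]≈y η (0<⇒≉0 0<a)))
        (<-respˡ-≈ (trans (+-identityʳ _) (*-comm ε (sum A)))
          (+-monoʳ-< (ε * sum A) (<-respʳ-≈ (sym (*-identityʳ ε)) (*-pos (⁻¹-pos 0<a) 0<η)))))
    where
    A : Vec _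
    A r = proj₁ (product-bound (y r))
    0<a : 0# < 1# + sum A
    0<a = +-pos-nonneg 0<1 (sum-nonneg (λ r → proj₁ (proj₂ (product-bound (y r)))))
    -- On the ε-box the functional is at most ε · sum A. The summand 1 keeps the divisor positive
    -- and makes the estimate strict: ε · sum A < ε · (1 + sum A) = η.
    ε = (1# + sum A) ⁻¹ * η

  scale-into-box : ∀ {d} (z : Vec d) {ε} → 0# < ε →
    ∃[ η ] 0# < η × (∀ r → η * z r < ε × - (η * z r) < ε)
  scale-into-box z {ε} 0<ε with sup-bound z | ∃-half 0<ε
  ... | a , 0<a , bound | h , 0<h , h+h≈ε = η , 0<η , λ r →
      lem (z r) (proj₁ (bound r))
    , <-respˡ-≈ (solve 2 (λ η z → η :* :- z := :- (η :* z)) refl η (z r)) (lem (- z r) (proj₂ (bound r)))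
    where
    -- The bound by `a` is not strict, so half of ε is aimed at.
    η = a ⁻¹ * h
    0<η : 0# < η
    0<η = *-pos (⁻¹-pos 0<a) 0<h
    h<ε : h < ε
    h<ε = <-respʳ-≈ h+h≈ε (<-respˡ-≈ (+-identityʳ h) (+-monoʳ-< h 0<h))
    lem : ∀ x → x ≤ a → η * x < ε
    lem x (inj₁ x<a) = <-trans (*-monoʳ-< 0<η x<a)
      (<-respˡ-≈ (sym (trans (*-comm η a) (x*[x⁻¹*y]≈y h (0<⇒≉0 0<a)))) h<ε)
    lem x (inj₂ x≈a) =
      <-respˡ-≈ (sym (trans (*-congˡ x≈a) (trans (*-comm η a) (x*[x⁻¹*y]≈y h (0<⇒≉0 0<a))))) h<ε

  Affine : ∀ {n d} → Vector (Vec d) n → Vec n → Set (c ⊔ ℓ₁)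
  Affine b φ = ∃[ y ] ∃[ γ ] (∀ v → φ v ≈ y ∙ b v + γ)

  affine-sum : ∀ {n d} {b : Vector (Vec d) n} {φ} ((y , γ , _) : Affine b φ) →
    ∀ w → sum (λ v → w v * φ v) ≈ y ∙ linComb w b + sum w * γ
  affine-sum {b = b} {φ} (y , γ , φ≈) w = begin
    sum (λ v → w v * φ v)
      ≈⟨ sum-cong-≋ (λ v → trans (*-congˡ (φ≈ v)) (distribˡ (w v) (y ∙ b v) γ)) ⟩
    sum (λ v → w v * (y ∙ b v) + w v * γ)
      ≈⟨ ∑-distrib-+ (λ v → w v * (y ∙ b v)) (λ v → w v * γ) ⟩
    sum (λ v → w v * (y ∙ b v)) + sum (λ v → w v * γ)
      ≈⟨ +-cong (sym (∙-linComb y w b)) (∑-*ʳ γ w) ⟩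
    y ∙ linComb w b + sum w * γ ∎

  affine-at : ∀ {n d} {b : Vector (Vec d) n} {φ} ((y , γ , _) : Affine b φ) →
    ∀ w {x} → sum w ≈ 1# → x ≋ linComb w b → y ∙ x + γ ≈ sum (λ v → w v * φ v)
  affine-at φ-affine@(y , γ , _) w ∑w≈1 x≋ = sym (trans (affine-sum φ-affine w)
    (+-cong (∙-congʳ y (λ r → sym (x≋ r))) (trans (*-congʳ ∑w≈1) (*-identityˡ γ))))

  -- Used twice: for affine relations, where sum w = 0, it gives independence of the vertices; for
  -- functions in the low eigenspaces it gives the design identity.
  affine-annihilated : ∀ {n d} {b : Vector (Vec d) n} {φ} ((_ , γ , _) : Affine b φ) →
    ∀ w → linComb w b ≋ 𝟎 → sum (λ v → w v * φ v) ≈ sum w * γ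
  affine-annihilated φ-affine@(y , _ , _) w lc≋0 = trans (affine-sum φ-affine w)
    (trans (+-congʳ (trans (∙-congʳ y lc≋0) (∙-zeroʳ y))) (+-identityˡ _))

  affine-nonneg : ∀ {n d} {b : Vector (Vec d) n} {φ} ((y , γ , _) : Affine b φ) →
    (∀ v → 0# ≤ φ v) → ∀ {x} → conv b x → 0# ≤ y ∙ x + γ
  affine-nonneg φ-affine 0≤φ (w , 0≤w , ∑w≈1 , x≋) = ≤-respʳ-≈ (sym (affine-at φ-affine w ∑w≈1 x≋))
    (sum-nonneg (λ v → *-nonneg (0≤w v) (0≤φ v)))

  -- A point b i in the relative interior lets the segment from b v be prolonged beyond b i
  -- inside the polytope, where an affine function vanishing at b i changes sign.
  zero-on-relative-interior : ∀ {n d ℓ} {b : Vector (Vec d) n} {F : Pred (Vec d) ℓ} → F ⊆ conv b →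
    ∀ {φ} → Affine b φ → (∀ v → 0# ≤ φ v) →
    ∀ i → RelativeInterior F (b i) → φ i ≈ 0# → ∀ v → F (b v) → φ v ≈ 0#
  zero-on-relative-interior {b = b} {F} F⊆P {φ} φ-aff@(y , γ , φ≈) 0≤φ i (Fi , ε , 0<ε , near) φi≈0 v Fv =
    ≤-antisym φv≤0 (0≤φ v)
    where
    scaling = scale-into-box (λ r → b i r - b v r) 0<ε
    η = proj₁ scaling
    0<η = proj₁ (proj₂ scaling)
    inBox = proj₂ (proj₂ scaling)
    w : Vec 2
    w = (1# + η) ∷ (- η) ∷ []
    p : Vector (Vec _) 2
    p = b i ∷ b v ∷ []
    x = linComb w p
    ∑w≈1 : sum w ≈ 1#
    ∑w≈1 = solve 1 (λ η → (con (+ 1) :+ η) :+ (:- η :+ con (+ 0)) := con (+ 1)) refl η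
    x-b : ∀ r → η * (b i r - b v r) ≈ x r - b i r
    x-b r = solve 3 (λ η x y →
      η :* (x :- y) := ((con (+ 1) :+ η) :* x :+ (:- η :* y :+ con (+ 0))) :- x) refl η (b i r) (b v r)
    b-x : ∀ r → - (η * (b i r - b v r)) ≈ b i r - x r
    b-x r = solve 3 (λ η x y →
      :- (η :* (x :- y)) := x :- ((con (+ 1) :+ η) :* x :+ (:- η :* y :+ con (+ 0)))) refl η (b i r) (b v r)
    Fx : F x
    Fx = near x (2 , p , w , (λ { zero → Fi ; (suc zero) → Fv }) , ∑w≈1 , λ r → refl)
      (λ r → <-respˡ-≈ (x-b r) (proj₁ (inBox r)) , <-respˡ-≈ (b-x r) (proj₂ (inBox r)))
    φx≈ : y ∙ x + γ ≈ η * (0# - φ v)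
    φx≈ = begin
      y ∙ x + γ
        ≈⟨ affine-at {b = p} {φ = φ i ∷ φ v ∷ []}
             (y , γ , λ { zero → φ≈ i ; (suc zero) → φ≈ v }) w ∑w≈1 (λ r → refl) ⟩
      (1# + η) * φ i + (- η * φ v + 0#)
        ≈⟨ +-congʳ (*-congˡ φi≈0) ⟩
      (1# + η) * 0# + (- η * φ v + 0#)
        ≈⟨ solve 2 (λ η x → (con (+ 1) :+ η) :* con (+ 0) :+ (:- η :* x :+ con (+ 0)) := η :* (con (+ 0) :- x))
             refl η (φ v) ⟩
      η * (0# - φ v) ∎
    φv≤0 : φ v ≤ 0#
    φv≤0 = 0≤y-x⇒x≤y (0≤xy⇒0≤y 0<η (≤-respʳ-≈ φx≈ (affine-nonneg φ-aff 0≤φ (F⊆P Fx))))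

-- Simplices spanned by averaging configurations, and their faces.

module AveragingConfigurations {c ℓ₁ ℓ₂ : Level} (𝕂 : OrderedField c ℓ₁ ℓ₂) where
  open OrderedFieldProperties 𝕂
  open WeightedSums 𝕂
  open ConvexGeometry 𝕂
  open Eigenpolytopes 𝕂 hiding (module Designs)

  -- Vectors at which every coordinate has, off V, the average of its earlier values,
  -- and which carry enough affine functions: they span a simplex with vertex set V.
  module AveragingConfiguration
      {n d : ℕ} (b : Vector (Vec d) n) (V : Fin n → Bool)
      (first∈V : ∀ v → toℕ v ≡ 0 → V v ≡ true)
      (b-averages : ∀ r → AveragesOff V (λ v → b v r))
      (affine : ∀ φ → AveragesOff V φ → Affine b φ) where
    open Barycentric V first∈V

    -- Weights stay indexed by all vertices, with a support condition, so that hulls of different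
    -- subsets share the same coordinates.
    Hull : (Fin n → Bool) → Pred (Vec d) (c ⊔ ℓ₁ ⊔ ℓ₂)
    Hull U x = ∃[ w ] (∀ v → 0# ≤ w v) × Supported U w × sum w ≈ 1# × x ≋ linComb w b

    coordinates : Fin n → Vec n
    coordinates v q = bary q v

    b≋linComb : ∀ v → b v ≋ linComb (coordinates v) b
    b≋linComb v r = interpolation (b-averages r) v

    -- On `V` the functions `bary q` are Kronecker deltas, and off `V` the weight is zero; so
    -- pairing with `bary q` reads off the weight at `q`.
    sum-supported : ∀ {w} → Supported V w → ∀ q → sum (λ v → w v * bary q v) ≈ w q
    sum-supported {w} w-supp q = begin
      sum (λ v → w v * bary q v)  ≈⟨ sum-cong-≋ lem ⟩
      sum (λ v → δ q v * w v)     ≈⟨ sum-δ q w ⟩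
      w q                         ∎
      where
      lem : ∀ v → w v * bary q v ≈ δ q v * w v
      lem v with V v in eq
      ... | true  = trans (*-congˡ (bary-on q v eq)) (*-comm (w v) (δ q v))
      ... | false = trans (*-congʳ (w-supp v eq)) (trans (zeroˡ _)
                      (sym (trans (*-congˡ (w-supp v eq)) (zeroʳ _))))

    -- An affine relation annihilates every affine function on the configuration, in particular
    -- `bary q`, whose pairing with `w` is `w q`.
    independent : ∀ w → Supported V w → sum w ≈ 0# → linComb w b ≋ 𝟎 → w ≋ 𝟎
    independent w w-supp ∑w≈0 lc≋0 q = trans (sym (sum-supported w-supp q))
      (trans (affine-annihilated (affine (bary q) (bary-averages q)) w lc≋0)
        (trans (*-congʳ ∑w≈0) (zeroˡ _)))

    recoordinatize : ∀ w → linComb (linComb w coordinates) b ≋ linComb w b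
    recoordinatize w r = trans (sym (linComb-linComb w coordinates b r))
      (linComb-congʳ w (λ i r → sym (b≋linComb i r)) r)

    -- Each point is replaced by its barycentric combination of the points of `V`. The coordinates
    -- are nonnegative with sum 1, so a convex combination stays one.
    conv≐Hull : conv b ≐ Hull V
    conv≐Hull =
        (λ (w , 0≤w , ∑w≈1 , x≋) →
            linComb w coordinates
          , (λ q → sum-nonneg (λ v → *-nonneg (0≤w v) (0≤bary q v)))
          , (λ q q∉V → sum-zero (λ v → trans (*-congˡ (bary-outside q v q∉V)) (zeroʳ (w v))))
          , trans (sum-linComb w coordinates sum-bary) ∑w≈1
          , (λ r → trans (x≋ r) (sym (recoordinatize w r))))
      , (λ (w , 0≤w , _ , ∑w≈1 , x≋) → w , 0≤w , ∑w≈1 , x≋)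

    module _ (U : Fin n → Bool) (U⊆V : ∀ v → V v ≡ false → U v ≡ false) where

      -- The equation lets the caller present `count U` as a successor, the form in which dimensions
      -- and simplices are stated.
      vertices : ∀ {m} → count U ≡ m → Σ (Vector (Vec d) m) λ p →
        AffinelyIndependent p × (∀ i → Hull U (p i)) × Hull U ≐ conv p
      vertices ≡.refl =
          (λ r → b (index U r))
        , (λ w ∑w≈0 lc≋0 r → trans (reflexive (≡.sym (extendByZero-index U w r)))
             (independent (extendByZero U w)
               (λ v v∉V → extendByZero-supported U w v (U⊆V v v∉V))
               (trans (sym (sum-extendByZero₁ U w)) ∑w≈0)
               (λ s → trans (sym (sum-extendByZero U w (λ v → b v s))) (lc≋0 s))
               (index U r)))
        , (λ r → δ (index U r) , 0≤δ (index U r)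
             , (λ v v∉U → reflexive (δ-≢ λ r≡v →
                  true≢false (≡.trans (≡.sym (index-∈ U r)) (≡.trans (≡.cong U r≡v) v∉U))))
             , sum-δ₁ (index U r)
             , (λ s → sym (linComb-δ (index U r) b s)))
        , (λ (w , 0≤w , w-supp , ∑w≈1 , x≋) →
               (λ r → w (index U r)) , (λ r → 0≤w (index U r))
             , trans (sum-index U w w-supp) ∑w≈1
             , (λ s → trans (x≋ s) (sym (sum-index U (λ v → w v * b v s)
                  (λ v v∉U → trans (*-congʳ (w-supp v v∉U)) (zeroˡ (b v s)))))))
        , (λ (w , 0≤w , ∑w≈1 , x≋) →
               extendByZero U w , extendByZero-nonneg w 0≤w , extendByZero-supported U w
             , trans (sym (sum-extendByZero₁ U w)) ∑w≈1
             , (λ s → trans (x≋ s) (sum-extendByZero U w (λ v → b v s))))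
        where
        extendByZero-nonneg : ∀ w → (∀ r → 0# ≤ w r) → ∀ v → 0# ≤ extendByZero U w v
        extendByZero-nonneg w 0≤w v = ≤-respʳ-≈
          (trans (sum-extendByZero U w (δ v))
            (trans (sum-cong-≋ (λ j → *-comm (extendByZero U w j) (δ v j))) (sum-δ v (extendByZero U w))))
          (sum-nonneg (λ r → *-nonneg (0≤w r) (0≤δ v (index U r))))

      dimension : ∀ {m} → count U ≡ suc m → HasDimension (Hull U) m
      dimension eq with vertices eq
      ... | p , p-indep , p∈ , ⊆conv , _ = p , p-indep , p∈ , λ x Hx →
        let w , _ , ∑w≈1 , x≋ = ⊆conv Hx in w , ∑w≈1 , x≋

      indicator : Vec n
      indicator q = if U q then 1# else 0#

      0≤1-indicator : ∀ q → 0# ≤ 1# - indicator q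
      0≤1-indicator q with U q
      ... | true  = inj₂ (sym (-‿inverseʳ 1#))
      ... | false = x≤y⇒0≤y-x 0≤1

      -- The barycentric weight carried by `U`. It never exceeds 1, and the hull of `U` is where its
      -- affine extension equals 1.
      faceFunctional : Vec n
      faceFunctional v = sum (λ q → indicator q * bary q v)

      faceFunctional-averages : AveragesOff V faceFunctional
      faceFunctional-averages = averagesOff-linear indicator bary bary-averages

      faceFunctional-on : ∀ v → V v ≡ true → faceFunctional v ≈ indicator v
      faceFunctional-on v v∈V = trans
        (sum-cong-≋ (λ q → trans
          (*-congˡ (trans (bary-on q v v∈V) (reflexive (δ-sym q v)))) (*-comm (indicator q) (δ v q))))
        (sum-δ v indicator)

      1-faceFunctional : ∀ v → sum (λ q → (1# - indicator q) * bary q v) ≈ 1# - faceFunctional v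
      1-faceFunctional v = begin
        sum (λ q → (1# - indicator q) * bary q v)
          ≈⟨ sum-cong-≋ (λ q → solve 2 (λ x y → (con (+ 1) :- x) :* y := y :- x :* y) refl (indicator q) (bary q v)) ⟩
        sum (λ q → bary q v - indicator q * bary q v)
          ≈⟨ sum-sub (λ q → bary q v) (λ q → indicator q * bary q v) ⟩
        sum (λ q → bary q v) - faceFunctional v
          ≈⟨ +-congʳ (sum-bary v) ⟩
        1# - faceFunctional v ∎

      0≤1-faceFunctional : ∀ v → 0# ≤ 1# - faceFunctional v
      0≤1-faceFunctional v = ≤-respʳ-≈ (1-faceFunctional v)
        (sum-nonneg (λ q → *-nonneg (0≤1-indicator q) (0≤bary q v)))

      bary≤1-faceFunctional : ∀ q v → U q ≡ false → bary q v ≤ 1# - faceFunctional v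
      bary≤1-faceFunctional q v q∉U = ≤-respʳ-≈ (1-faceFunctional v)
        (≤-respˡ-≈ (trans (*-congʳ (1-indicator≈1 q q∉U)) (*-identityˡ _))
          (term≤sum (λ q → *-nonneg (0≤1-indicator q) (0≤bary q v)) q))
        where
        1-indicator≈1 : ∀ q → U q ≡ false → 1# - indicator q ≈ 1#
        1-indicator≈1 q q∉U rewrite q∉U = solve 0 (con (+ 1) :- con (+ 0) := con (+ 1)) refl

      sum-*-faceFunctional : ∀ w → Supported U w → sum (λ v → w v * faceFunctional v) ≈ sum w
      sum-*-faceFunctional w w-supp = sum-cong-≋ lem
        where
        lem : ∀ v → w v * faceFunctional v ≈ w v
        lem v with U v in u | V v in eq
        ... | false | _     = trans (*-congʳ (w-supp v u)) (trans (zeroˡ _) (sym (w-supp v u)))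
        ... | true  | true  = trans
          (*-congˡ (trans (faceFunctional-on v eq) (reflexive (≡.cong (if_then 1# else 0#) u)))) (*-identityʳ (w v))
        ... | true  | false = ⊥-elim (true≢false (≡.trans (≡.sym u) (U⊆V v eq)))

      sum-*-1-faceFunctional : ∀ w → sum w ≈ 1# →
        sum (λ v → w v * (1# - faceFunctional v)) ≈ 1# - sum (λ v → w v * faceFunctional v)
      sum-*-1-faceFunctional w ∑w≈1 = begin
        sum (λ v → w v * (1# - faceFunctional v))
          ≈⟨ sum-cong-≋ (λ v → solve 2 (λ x y → x :* (con (+ 1) :- y) := x :- x :* y) refl (w v) (faceFunctional v)) ⟩
        sum (λ v → w v - w v * faceFunctional v)
          ≈⟨ sum-sub w (λ v → w v * faceFunctional v) ⟩
        sum w - sum (λ v → w v * faceFunctional v)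
          ≈⟨ +-congʳ ∑w≈1 ⟩
        1# - sum (λ v → w v * faceFunctional v) ∎

      face : ∃[ a ] ∃[ γ ] IsFaceCutBy (conv b) (Hull U) a (1# - γ) × (∀ v → faceFunctional v ≈ a ∙ b v + γ)
      face = a , γ , (valid , tight) , χ≈
        where
        χ = affine faceFunctional faceFunctional-averages
        a = proj₁ χ
        γ = proj₁ (proj₂ χ)
        χ≈ = proj₂ (proj₂ χ)
        gap : ∀ {x} ((w , _) : conv b x) →
          sum (λ v → w v * (1# - faceFunctional v)) ≈ (1# - γ) - a ∙ x
        gap {x} (w , _ , ∑w≈1 , x≋) = begin
          sum (λ v → w v * (1# - faceFunctional v))  ≈⟨ sum-*-1-faceFunctional w ∑w≈1 ⟩
          1# - sum (λ v → w v * faceFunctional v)    ≈⟨ +-congˡ (-‿cong (affine-at χ w ∑w≈1 x≋)) ⟨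
          1# - (a ∙ x + γ)
            ≈⟨ solve 3 (λ o x γ → o :- (x :+ γ) := (o :- γ) :- x) refl 1# (a ∙ x) γ ⟩
          (1# - γ) - a ∙ x                           ∎

        valid : ∀ x → conv b x → a ∙ x ≤ 1# - γ
        valid x Px@(w , 0≤w , _) = 0≤y-x⇒x≤y (≤-respʳ-≈ (gap Px)
          (sum-nonneg (λ v → *-nonneg (0≤w v) (0≤1-faceFunctional v))))

        tight : Hull U ≐ (λ x → conv b x × a ∙ x ≈ 1# - γ)
        tight =
            (λ {x} (w , 0≤w , w-supp , ∑w≈1 , x≋) →
               (w , 0≤w , ∑w≈1 , x≋) , (begin
                 a ∙ x                                       ≈⟨ solve 2 (λ x γ → x := (x :+ γ) :- γ) refl (a ∙ x) γ ⟩
                 (a ∙ x + γ) - γ                             ≈⟨ +-congʳ (affine-at χ w ∑w≈1 x≋) ⟩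
                 sum (λ v → w v * faceFunctional v) - γ      ≈⟨ +-congʳ (trans (sum-*-faceFunctional w w-supp) ∑w≈1) ⟩
                 1# - γ                                      ∎))
          , (λ {x} (Px@(w , 0≤w , ∑w≈1 , x≋) , ax≈) →
               -- Tightness makes a sum of nonnegative terms vanish, so every term w v · (1 -
               -- `faceFunctional v`) is zero. For `q` outside `U` this term bounds w v ·
               -- `bary q v`, so the new coordinate at `q` is zero.
               let slack = sum≈0⇒term≈0 (λ v → *-nonneg (0≤w v) (0≤1-faceFunctional v))
                             (trans (gap Px) (x≈y⇒x-y≈0 (sym ax≈)))
               in linComb w coordinates
                , (λ q → sum-nonneg (λ v → *-nonneg (0≤w v) (0≤bary q v)))
                , (λ q q∉U → sum-zero (λ v → sym (≤-antisym (*-nonneg (0≤w v) (0≤bary q v))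
                     (≤-trans (*-monoʳ-≤ (0≤w v) (bary≤1-faceFunctional q v q∉U)) (inj₂ (slack v))))))
                , trans (sum-linComb w coordinates sum-bary) ∑w≈1
                , (λ r → trans (x≋ r) (sym (recoordinatize w r))))

      -- A point of the affine hull has weights supported on `U` with sum 1, so only their signs are
      -- in question. Each weight is an affine function of the point and is positive at `b i`, hence
      -- also nearby.
      relative-interior : ∀ i → Supported U (coordinates i) → (∀ q → U q ≡ true → 0# < bary q i) →
        RelativeInterior (Hull U) (b i)
      relative-interior i supp 0<bary =
          (coordinates i , (λ q → 0≤bary q i) , supp , sum-bary i , b≋linComb i)
        , ε , 0<ε , near
        where
        Y : Fin n → Vec d
        Y q = proj₁ (affine (bary q) (bary-averages q))

        radius : ∀ q → ∃[ ε ] 0# < ε × (U q ≡ true → ∀ z → (∀ r → z r < ε × - z r < ε) → Y q ∙ z < bary q i)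
        radius q = bool-cases (U q)
          (λ q∈U → let ε , 0<ε , cont = functional-continuous (Y q) (0<bary q q∈U) in ε , 0<ε , λ _ → cont)
          -- Outside `U` the weight is zero anyway, so any positive radius will do.
          (λ q∉U → 1# , 0<1 , λ q∈U → ⊥-elim (true≢false (≡.trans (≡.sym q∈U) q∉U)))
        radii = lower-bound (λ q → proj₁ (radius q)) (λ q → proj₁ (proj₂ (radius q)))
        ε = proj₁ radii
        0<ε = proj₁ (proj₂ radii)
        ε≤ = proj₂ (proj₂ radii)

        near : ∀ y → affineHull (Hull U) y → (∀ r → y r - b i r < ε × b i r - y r < ε) → Hull U y
        near y (m , p , w , p∈ , ∑w≈1 , y≋) close = ŵ , 0≤ŵ , ŵ-supp , ∑ŵ≈1 , y≋ŵ
          where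
          g : Vector (Vec n) m
          g j = proj₁ (p∈ j)
          ŵ = linComb w g
          ŵ-supp : Supported U ŵ
          ŵ-supp v v∉U = sum-zero (λ j → trans (*-congˡ (proj₁ (proj₂ (proj₂ (p∈ j))) v v∉U)) (zeroʳ (w j)))
          ∑ŵ≈1 : sum ŵ ≈ 1#
          ∑ŵ≈1 = trans (sum-linComb w g (λ j → proj₁ (proj₂ (proj₂ (proj₂ (p∈ j)))))) ∑w≈1
          y≋ŵ : y ≋ linComb ŵ b
          y≋ŵ r = trans (y≋ r) (trans
            (linComb-congʳ w (λ j → proj₂ (proj₂ (proj₂ (proj₂ (p∈ j))))) r) (linComb-linComb w g b r))
          0≤ŵ : ∀ q → 0# ≤ ŵ q
          0≤ŵ q = bool-cases (U q)
            (λ q∈U → inj₁ (0<y-x⇒x<y (<-respʳ-≈ value (x<y⇒0<y-x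
                (proj₂ (proj₂ (radius q)) q∈U (λ r → b i r - y r) (λ r →
                    <-≤-trans (proj₂ (close r)) (ε≤ q)
                  , <-respˡ-≈ (solve 2 (λ x y → x :- y := :- (y :- x)) refl (y r) (b i r))
                      (<-≤-trans (proj₁ (close r)) (ε≤ q))))))))
            (λ q∉U → inj₂ (sym (ŵ-supp q q∉U)))
            where
            γ = proj₁ (proj₂ (affine (bary q) (bary-averages q)))
            -- The left side is the weight at `b i` minus its drop from `b i` to `y`, and the
            -- continuity estimate says that this drop is less than `bary q i`.
            value : bary q i - Y q ∙ (λ r → b i r - y r) ≈ ŵ q - 0#
            value = begin
              bary q i - Y q ∙ (λ r → b i r - y r)
                ≈⟨ +-cong (proj₂ (proj₂ (affine (bary q) (bary-averages q))) i) (-‿cong (∙-sub (Y q) (b i) y)) ⟩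
              (Y q ∙ b i + γ) - (Y q ∙ b i - Y q ∙ y)
                ≈⟨ solve 3 (λ x y γ → (x :+ γ) :- (x :- y) := y :+ γ) refl (Y q ∙ b i) (Y q ∙ y) γ ⟩
              Y q ∙ y + γ
                ≈⟨ affine-at (affine (bary q) (bary-averages q)) ŵ ∑ŵ≈1 y≋ŵ ⟩
              sum (λ v → ŵ v * bary q v)
                ≈⟨ sum-supported (λ v v∉V → ŵ-supp v (U⊆V v v∉V)) q ⟩
              ŵ q
                ≈⟨ solve 1 (λ x → x := x :- con (+ 0)) refl (ŵ q) ⟩
              ŵ q - 0# ∎

    polytope-dimension : ∀ {m} → count V ≡ suc m → HasDimension (conv b) m
    polytope-dimension eq with dimension V (λ v v∉V → v∉V) eq
    ... | p , p-indep , p∈ , span = p , p-indep , (λ i → proj₂ conv≐Hull (p∈ i)) ,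
      (λ x Px → span x (proj₁ conv≐Hull Px))

    isSimplex : ∀ {m} → count V ≡ suc m → IsSimplex (conv b)
    isSimplex {m} eq with vertices V (λ v v∉V → v∉V) eq
    ... | p , p-indep , _ , H⊆ , ⊆H = m , p , p-indep ,
      (λ Px → H⊆ (proj₁ conv≐Hull Px)) , (λ px → proj₂ conv≐Hull (⊆H px))

-- Vertex types determine adjacency.

module ThresholdType {n : ℕ} (G : Graph n) (thr : Graph.IsThreshold G) where
  open Graph G

  -- The first vertex is vacuously of both types and gets whichever `thr` supplies, so arguments
  -- about runs have to stay away from it.
  type : Fin n → Bool
  type i with thr i
  ... | inj₁ _ = true
  ... | inj₂ _ = false

  adj-type : ∀ i j → j Fin.< i → adj i j ≡ type i
  adj-type i j j<i with thr i
  ... | inj₁ p = p j j<i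
  ... | inj₂ p = p j j<i

  adj-typeʳ : ∀ i j → i Fin.< j → adj i j ≡ type j
  adj-typeʳ i j i<j = ≡.trans (sym i j) (adj-type j i i<j)

-- The Laplacian and the orthogonality of its eigenspaces.

module LaplacianProperties {c ℓ₁ ℓ₂ : Level} (𝕂 : OrderedField c ℓ₁ ℓ₂) {n : ℕ} (G : Graph n) where
  open OrderedFieldProperties 𝕂
  open ConvexGeometry 𝕂
  open Eigenpolytopes 𝕂 hiding (module Designs; Vec)
  open Graph G using (adj; irrefl; degree)

  ⟦_⟧ : Bool → Carrier
  ⟦ b ⟧ = if b then 1# else 0#

  degree≈ : ∀ v → degree v · 1# ≈ sum (λ j → ⟦ adj v j ⟧)
  degree≈ v = cardinality (adj v)
    where
    ∣∷∣ : ∀ {m} a (p : Subset m) → ∣ a Vec.∷ p ∣ · 1# ≈ ⟦ a ⟧ + ∣ p ∣ · 1#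
    ∣∷∣ true  p = refl
    ∣∷∣ false p = sym (+-identityˡ _)
    cardinality : ∀ {m} (f : Fin m → Bool) → ∣ tabulate f ∣ · 1# ≈ sum (λ j → ⟦ f j ⟧)
    cardinality {zero}  f = refl
    cardinality {suc m} f = trans (∣∷∣ (f zero) (tabulate (f ∘ suc))) (+-congˡ (cardinality (f ∘ suc)))

  laplacian≈ : ∀ v j → laplacian G v j ≈ δ v j * (degree v · 1#) - ⟦ adj v j ⟧
  laplacian≈ v j with v Fin.≟ j
  ... | yes ≡.refl rewrite δ-refl v | irrefl v =
    solve 1 (λ x → x := con (+ 1) :* x :- con (+ 0)) refl (degree v · 1#)
  ... | no v≢j rewrite δ-≢ v≢j with adj v j
  ...   | true  = solve 1 (λ x → :- con (+ 1) := con (+ 0) :* x :- con (+ 1)) refl (degree v · 1#)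
  ...   | false = solve 1 (λ x → con (+ 0) := con (+ 0) :* x :- con (+ 0)) refl (degree v · 1#)

  -- The degree is the row sum of the adjacency matrix, so the diagonal term merges into differences
  -- along edges.
  laplacian-∙ : ∀ v f → laplacian G v ∙ f ≈ sum (λ j → ⟦ adj v j ⟧ * (f v - f j))
  laplacian-∙ v f = begin
    sum (λ j → laplacian G v j * f j)
      ≈⟨ sum-cong-≋ (λ j → trans (*-congʳ (laplacian≈ v j))
           (solve 4 (λ x y a z → (x :* y :- a) :* z := x :* (y :* z) :- a :* z) refl
              (δ v j) (degree v · 1#) ⟦ adj v j ⟧ (f j))) ⟩
    sum (λ j → δ v j * (degree v · 1# * f j) - ⟦ adj v j ⟧ * f j)
      ≈⟨ sum-sub (λ j → δ v j * (degree v · 1# * f j)) (λ j → ⟦ adj v j ⟧ * f j) ⟩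
    sum (λ j → δ v j * (degree v · 1# * f j)) - sum (λ j → ⟦ adj v j ⟧ * f j)
      ≈⟨ +-congʳ (trans (sum-δ v (λ j → degree v · 1# * f j))
           (trans (*-congʳ (degree≈ v)) (*-distribʳ-sum (f v) (λ j → ⟦ adj v j ⟧)))) ⟩
    sum (λ j → ⟦ adj v j ⟧ * f v) - sum (λ j → ⟦ adj v j ⟧ * f j)
      ≈⟨ sum-sub (λ j → ⟦ adj v j ⟧ * f v) (λ j → ⟦ adj v j ⟧ * f j) ⟨
    sum (λ j → ⟦ adj v j ⟧ * f v - ⟦ adj v j ⟧ * f j)
      ≈⟨ sum-cong-≋ (λ j → solve 3 (λ a x y → a :* x :- a :* y := a :* (x :- y)) refl ⟦ adj v j ⟧ (f v) (f j)) ⟩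
    sum (λ j → ⟦ adj v j ⟧ * (f v - f j)) ∎

  laplacian-sym : ∀ v j → laplacian G v j ≈ laplacian G j v
  laplacian-sym v j with v Fin.≟ j | j Fin.≟ v
  ... | yes ≡.refl | yes _   = refl
  ... | yes ≡.refl | no  j≢j = ⊥-elim (j≢j ≡.refl)
  ... | no  v≢v | yes ≡.refl = ⊥-elim (v≢v ≡.refl)
  ... | no  _   | no  _   rewrite Graph.sym G v j = refl

  -- By symmetry μ⟨f,g⟩ = ⟨Lf,g⟩ = ⟨f,Lg⟩ = ν⟨f,g⟩, and μ - ν can be cancelled.
  eigenspaces-orthogonal : ∀ {μ ν f g} → ¬ (μ ≈ ν) → Eigenspace G μ f → Eigenspace G ν g → f ∙ g ≈ 0#
  eigenspaces-orthogonal {μ} {ν} {f} {g} μ≉ν f∈ g∈ =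
    *-zero-cancelˡ {μ - ν} (λ p → μ≉ν (x-y≈0⇒x≈y p)) (begin
      (μ - ν) * (f ∙ g)
        ≈⟨ solve 3 (λ x y z → (x :- y) :* z := x :* z :- y :* z) refl μ ν (f ∙ g) ⟩
      μ * (f ∙ g) - ν * (f ∙ g)
        ≈⟨ x≈y⇒x-y≈0 (begin
          μ * (f ∙ g)
            ≈⟨ *-distribˡ-sum μ (λ v → f v * g v) ⟩
          sum (λ v → μ * (f v * g v))
            ≈⟨ sum-cong-≋ (λ v → trans (sym (*-assoc μ (f v) (g v)))
                 (trans (*-congʳ (sym (f∈ v))) (*-comm (laplacian G v ∙ f) (g v)))) ⟩
          sum (λ v → g v * (laplacian G v ∙ f))
            ≈⟨ sum-cong-≋ (λ v → *-congˡ (∙-comm (laplacian G v) f)) ⟩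
          sum (λ v → g v * (f ∙ laplacian G v))
            ≈⟨ ∙-linComb f g (laplacian G) ⟨
          f ∙ linComb g (laplacian G)
            ≈⟨ ∙-congʳ f (λ j → sum-cong-≋ (λ v → trans (*-congˡ (laplacian-sym v j)) (*-comm (g v) _))) ⟩
          f ∙ (λ j → laplacian G j ∙ g)
            ≈⟨ sum-cong-≋ (λ j → trans (*-congˡ (g∈ j))
                 (solve 3 (λ x y z → x :* (y :* z) := y :* (x :* z)) refl (f j) ν (g j))) ⟩
          sum (λ j → ν * (f j * g j))
            ≈⟨ ∑-*ˡ ν (λ j → f j * g j) ⟩
          ν * (f ∙ g) ∎) ⟩
      0# ∎)

  eigenspace-zero : ∀ μ {f} → f ≋ 𝟎 → Eigenspace G μ f
  eigenspace-zero μ {f} f≋0 v = trans (trans (∙-congʳ (laplacian G v) f≋0) (∙-zeroʳ (laplacian G v)))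
    (sym (trans (*-congˡ (f≋0 v)) (zeroʳ μ)))

  constant∈kernel : ∀ x → Eigenspace G 0# (λ _ → x)
  constant∈kernel x v = trans (laplacian-∙ v (λ _ → x)) (trans
    (sum-zero (λ j → trans (*-congˡ {⟦ adj v j ⟧} (-‿inverseʳ x)) (zeroʳ ⟦ adj v j ⟧)))
    (sym (zeroˡ x)))

-- The vectors 1_{v < i} − i 1_{v = i} together with the constants form an
-- orthogonal basis of functions on Fin n; it diagonalises every threshold Laplacian.
module OrthogonalBasis {c ℓ₁ ℓ₂ : Level} (𝕂 : OrderedField c ℓ₁ ℓ₂) {n : ℕ} where
  open OrderedFieldProperties 𝕂
  open WeightedSums 𝕂
  open ConvexGeometry 𝕂
  open Eigenpolytopes 𝕂 hiding (module Designs)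

  ⟨_⟩ : Fin n → Carrier
  ⟨ i ⟩ = toℕ i · 1#

  u : Fin n → Vec n
  u i v = below i v - ⟨ i ⟩ * δ i v

  u-< : ∀ {i v} → v Fin.< i → u i v ≈ 1#
  u-< {i} {v} v<i rewrite below-< v<i | δ-≢ {i = i} {v} (λ p → Fin.<⇒≢ v<i (≡.sym p)) =
    solve 1 (λ x → con (+ 1) :- x :* con (+ 0) := con (+ 1)) refl ⟨ i ⟩

  u-≡ : ∀ i → u i i ≈ - ⟨ i ⟩
  u-≡ i rewrite below-≮ {i = i} {i} (ℕ.<-irrefl ≡.refl) | δ-refl i =
    solve 1 (λ x → con (+ 0) :- x :* con (+ 1) := :- x) refl ⟨ i ⟩

  u-> : ∀ {i v} → i Fin.< v → u i v ≈ 0#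
  u-> {i} {v} i<v rewrite below-≮ {i = i} {v} (ℕ.<-asym i<v) | δ-≢ (Fin.<⇒≢ i<v) =
    solve 1 (λ x → con (+ 0) :- x :* con (+ 0) := con (+ 0)) refl ⟨ i ⟩

  u-first : ∀ i → toℕ i ≡ 0 → u i ≋ 𝟎
  u-first i i≡0 v with Fin.<-cmp v i
  ... | tri< v<i _ _ with () ← ≡.subst (toℕ v ℕ.<_) i≡0 v<i
  ... | tri≈ _ ≡.refl _ = trans (u-≡ i) (trans (-‿cong (reflexive (≡.cong (_· 1#) i≡0)))
    (solve 0 (:- con (+ 0) := con (+ 0)) refl))
  ... | tri> _ _ i<v = u-> i<v

  -- Pairing with `u i` measures the failure of the averaging rule at `i`; orthogonality to `u i` is
  -- exactly that rule.
  u-∙ : ∀ i g → u i ∙ g ≈ prefix i g - ⟨ i ⟩ * g i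
  u-∙ i g = begin
    sum (λ v → (below i v - ⟨ i ⟩ * δ i v) * g v)
      ≈⟨ sum-cong-≋ (λ v → solve 4 (λ b x d g → (b :- x :* d) :* g := b :* g :- x :* (d :* g)) refl
           (below i v) ⟨ i ⟩ (δ i v) (g v)) ⟩
    sum (λ v → below i v * g v - ⟨ i ⟩ * (δ i v * g v))
      ≈⟨ sum-sub (λ v → below i v * g v) (λ v → ⟨ i ⟩ * (δ i v * g v)) ⟩
    prefix i g - sum (λ v → ⟨ i ⟩ * (δ i v * g v))
      ≈⟨ +-congˡ (-‿cong (trans (∑-*ˡ ⟨ i ⟩ (λ v → δ i v * g v)) (*-congˡ (sum-δ i g)))) ⟩
    prefix i g - ⟨ i ⟩ * g i ∎

  prefix-1 : ∀ i {f : Vec n} → (∀ j → j Fin.< i → f j ≈ 1#) → prefix i f ≈ ⟨ i ⟩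
  prefix-1 i {f} f≈1 = trans (prefix-cong i {f} {λ _ → 1#} f≈1)
    (trans (sum-cong-≋ (λ j → *-identityʳ (below i j))) (sum-below i))

  sum-u : ∀ i → sum (u i) ≈ 0#
  sum-u i = begin
    sum (u i)                  ≈⟨ sum-cong-≋ (λ v → sym (*-identityʳ (u i v))) ⟩
    u i ∙ (λ _ → 1#)           ≈⟨ u-∙ i (λ _ → 1#) ⟩
    prefix i (λ _ → 1#) - ⟨ i ⟩ * 1#  ≈⟨ x≈y⇒x-y≈0 (trans (prefix-1 i (λ _ _ → refl)) (sym (*-identityʳ _))) ⟩
    0#                         ∎

  u-∙-const : ∀ i x → u i ∙ (λ _ → x) ≈ 0#
  u-∙-const i x = trans (∑-*ʳ x (u i)) (trans (*-congʳ (sum-u i)) (zeroˡ x))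

  -- The vector of the later index is constantly 1 on the support of the other, whose entries sum to
  -- zero.
  u-∙-u : ∀ {i j} → i ≢ j → u i ∙ u j ≈ 0#
  u-∙-u {i} {j} i≢j with Fin.<-cmp i j
  ... | tri< i<j _ _ = lem i<j
    where
    lem : ∀ {i j} → i Fin.< j → u i ∙ u j ≈ 0#
    lem {i} {j} i<j = trans (u-∙ i (u j)) (x≈y⇒x-y≈0 (trans
      (prefix-1 i {u j} (λ l l<i → u-< (ℕ.<-trans l<i i<j)))
      (sym (trans (*-congˡ (u-< i<j)) (*-identityʳ _)))))
  ... | tri≈ _ i≡j _ = ⊥-elim (i≢j i≡j)
  ... | tri> _ _ j<i = trans (∙-comm (u i) (u j)) (trans (u-∙ j (u i)) (x≈y⇒x-y≈0 (trans
      (prefix-1 j {u i} (λ l l<j → u-< (ℕ.<-trans l<j j<i)))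
      (sym (trans (*-congˡ (u-< j<i)) (*-identityʳ _))))))

  ‖u‖² : ∀ i → u i ∙ u i ≈ ⟨ i ⟩ + ⟨ i ⟩ * ⟨ i ⟩
  ‖u‖² i = begin
    u i ∙ u i                      ≈⟨ u-∙ i (u i) ⟩
    prefix i (u i) - ⟨ i ⟩ * u i i  ≈⟨ +-cong (prefix-1 i {u i} (λ _ → u-<)) (-‿cong (*-congˡ (u-≡ i))) ⟩
    ⟨ i ⟩ - ⟨ i ⟩ * - ⟨ i ⟩         ≈⟨ solve 1 (λ x → x :- x :* :- x := x :+ x :* x) refl ⟨ i ⟩ ⟩
    ⟨ i ⟩ + ⟨ i ⟩ * ⟨ i ⟩           ∎

  0<⟨_⟩ : ∀ {i} → 1 ℕ.≤ toℕ i → 0# < ⟨ i ⟩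
  0<⟨_⟩ {i} 1≤i with toℕ i
  ... | suc m = 0<1+n·1 m

  0<‖u‖² : ∀ i → 1 ℕ.≤ toℕ i → 0# < u i ∙ u i
  0<‖u‖² i 1≤i = <-respʳ-≈ (sym (‖u‖² i)) (+-pos-nonneg 0<⟨ 1≤i ⟩ (inj₁ (*-pos 0<⟨ 1≤i ⟩ 0<⟨ 1≤i ⟩)))

  0<n : Fin n → 0# < n · 1#
  0<n i = lem i
    where
    lem : ∀ {m} → Fin m → 0# < m · 1#
    lem {suc m} _ = 0<1+n·1 m

  -- Orthogonality to all `u i` makes every value after the first the average of the earlier ones,
  -- so `g` is constant, and its sum being zero makes it vanish.
  complete : ∀ g → sum g ≈ 0# → (∀ i → u i ∙ g ≈ 0#) → g ≋ 𝟎
  complete g ∑g≈0 g⊥u v = trans (g≈gv v) (*-zero-cancelˡ (0<⇒≉0 (0<n v)) (begin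
    n · 1# * g v              ≈⟨ sum-const n (g v) ⟨
    sum {n} (λ _ → g v)       ≈⟨ sum-cong-≋ g≈gv ⟨
    sum g                     ≈⟨ ∑g≈0 ⟩
    0#                        ∎))
    where
    open Barycentric isFirst ≡0⇒isFirst
    g-averages : AveragesOff isFirst g
    g-averages j _ = sym (x-y≈0⇒x≈y (trans (sym (u-∙ j g)) (g⊥u j)))
    first : Fin n
    first = Fin.fromℕ< (ℕ.≤-<-trans z≤n (Fin.toℕ<n v))
    g≈first : ∀ j → g j ≈ g first
    g≈first = averagesOff-unique g-averages (averagesOff-const (g first))
      (λ j j-first → reflexive (≡.cong g (Fin.toℕ-injective
        (≡.trans (isFirst⇒≡0 j j-first) (≡.sym (Fin.toℕ-fromℕ< _))))))
    g≈gv : ∀ j → g j ≈ g v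
    g≈gv j = trans (g≈first j) (sym (g≈first v))

  mean : Vec n → Carrier
  mean g = (n · 1#) ⁻¹ * sum g

  sum-mean : ∀ g → Fin n → sum {n} (λ _ → mean g) ≈ sum g
  sum-mean g i = begin
    sum {n} (λ _ → mean g)      ≈⟨ sum-const n (mean g) ⟩
    n · 1# * mean g             ≈⟨ x*[x⁻¹*y]≈y (sum g) (0<⇒≉0 (0<n i)) ⟩
    sum g                       ∎

  -- At the first vertex the inverse of zero is unspecified, but it multiplies `u i ∙ g`, which is
  -- zero there.
  coefficient : Vec n → Vec n
  coefficient g i = (u i ∙ u i) ⁻¹ * (u i ∙ g)

  expansion : ∀ g v → g v ≈ linComb (coefficient g) u v + mean g
  expansion g v = x-y≈0⇒x≈y (trans
    (solve 3 (λ x y z → x :- (y :+ z) := (x :- y) :- z) refl (g v) (s v) (mean g))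
    (complete residual ∑residual residual⊥u v))
    where
    s = linComb (coefficient g) u
    residual : Vec n
    residual j = (g j - s j) - mean g
    ∑s : sum s ≈ 0#
    ∑s = begin
      sum (λ j → sum (λ i → coefficient g i * u i j))  ≈⟨ ∑-comm (λ j i → coefficient g i * u i j) ⟩
      sum (λ i → sum (λ j → coefficient g i * u i j))
        ≈⟨ sum-zero (λ i → trans (∑-*ˡ (coefficient g i) (u i)) (trans (*-congˡ (sum-u i)) (zeroʳ _))) ⟩
      0# ∎
    ∑residual : sum residual ≈ 0#
    ∑residual = begin
      sum residual
        ≈⟨ sum-sub (λ j → g j - s j) (λ _ → mean g) ⟩
      sum (λ j → g j - s j) - sum {n} (λ _ → mean g)
        ≈⟨ +-cong (trans (sum-sub g s) (+-congˡ (-‿cong ∑s))) (-‿cong (sum-mean g v)) ⟩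
      (sum g - 0#) - sum g
        ≈⟨ solve 1 (λ x → (x :- con (+ 0)) :- x := con (+ 0)) refl (sum g) ⟩
      0# ∎
    u-∙-s : ∀ i → u i ∙ s ≈ coefficient g i * (u i ∙ u i)
    u-∙-s i = begin
      u i ∙ s                                                ≈⟨ ∙-linComb (u i) (coefficient g) u ⟩
      sum (λ j → coefficient g j * (u i ∙ u j))              ≈⟨ sum-cong-≋ lem ⟩
      sum (λ j → δ i j * (coefficient g j * (u i ∙ u j)))    ≈⟨ sum-δ i (λ j → coefficient g j * (u i ∙ u j)) ⟩
      coefficient g i * (u i ∙ u i) ∎
      where
      lem : ∀ j → coefficient g j * (u i ∙ u j) ≈ δ i j * (coefficient g j * (u i ∙ u j))
      lem j with i Fin.≟ j
      ... | yes ≡.refl = sym (trans (*-congʳ (reflexive (δ-refl i))) (*-identityˡ _))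
      ... | no i≢j = trans (trans (*-congˡ (u-∙-u i≢j)) (zeroʳ _))
                           (sym (trans (*-congʳ (reflexive (δ-≢ i≢j))) (zeroˡ _)))
    residual⊥u : ∀ i → u i ∙ residual ≈ 0#
    residual⊥u i with 1 ℕ.≤? toℕ i
    ... | no  1≰i = sum-zero (λ j → trans (*-congʳ (u-first i (ℕ.n<1⇒n≡0 (ℕ.≰⇒> 1≰i)) j)) (zeroˡ _))
    ... | yes 1≤i = begin
      u i ∙ residual
        ≈⟨ ∙-sub (u i) (λ j → g j - s j) (λ _ → mean g) ⟩
      u i ∙ (λ j → g j - s j) - u i ∙ (λ _ → mean g)
        ≈⟨ +-cong (∙-sub (u i) g s) (-‿cong (u-∙-const i (mean g))) ⟩
      (u i ∙ g - u i ∙ s) - 0#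
        ≈⟨ +-congʳ (x≈y⇒x-y≈0 (sym (trans (u-∙-s i) (trans (*-comm _ _)
             (x*[x⁻¹*y]≈y (u i ∙ g) (0<⇒≉0 (0<‖u‖² i 1≤i))))))) ⟩
      0# - 0#
        ≈⟨ -‿inverseʳ 0# ⟩
      0# ∎

-- Eigenvalues of a threshold Laplacian.

module ThresholdSpectrum {c ℓ₁ ℓ₂ : Level} (𝕂 : OrderedField c ℓ₁ ℓ₂)
                         {n : ℕ} (G : Graph n) (thr : Graph.IsThreshold G) where
  open OrderedFieldProperties 𝕂
  open Eigenpolytopes 𝕂 hiding (module Designs)
  open Graph G using (adj; irrefl)
  open ThresholdType G thr
  open LaplacianProperties 𝕂 G
  open OrthogonalBasis 𝕂 {n}

  -- The adjacency matrix with the diagonal filled in by the vertex types: distinct vertices are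
  -- adjacent exactly when the later one is dominating.
  typeOfMax : Fin n → Fin n → Carrier
  typeOfMax i j = ⟦ if ⌊ i Fin.<? j ⌋ then type j else type i ⟧

  typeOfMax-< : ∀ {i j} → i Fin.< j → typeOfMax i j ≡ ⟦ type j ⟧
  typeOfMax-< {i} {j} i<j with i Fin.<? j
  ... | yes _   = ≡.refl
  ... | no  i≮j = ⊥-elim (i≮j i<j)

  typeOfMax-≮ : ∀ {i j} → ¬ (i Fin.< j) → typeOfMax i j ≡ ⟦ type i ⟧
  typeOfMax-≮ {i} {j} i≮j with i Fin.<? j
  ... | yes i<j = ⊥-elim (i≮j i<j)
  ... | no  _   = ≡.refl

  -- Vertices up to `i` contribute `toℕ i` + 1 if `i` is dominating and nothing otherwise; after
  -- `i`, each dominating vertex contributes 1.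
  μ : Fin n → Carrier
  μ i = sum (typeOfMax i)

  private
    -- Splits the Laplacian so that the second term, summed over `j`, is a multiple of `sum (u i)` =
    -- 0 and the first is the eigenvalue times `u i v`.
    termwise : ∀ i v j → ⟦ adj v j ⟧ * (u i v - u i j) ≈ typeOfMax i j * u i v - typeOfMax v i * u i j
    termwise i v j = go (Fin.<-cmp v i) (Fin.<-cmp j i)
      where
      by : ∀ {a x y m m′ a′ x′ y′ p p′} → a ≡ a′ → x ≈ x′ → y ≈ y′ → m ≡ p → m′ ≡ p′ →
           a′ * (x′ - y′) ≈ p * x′ - p′ * y′ → a * (x - y) ≈ m * x - m′ * y
      by ≡.refl x≈ y≈ ≡.refl ≡.refl eq = trans (*-congˡ (+-cong x≈ (-‿cong y≈)))
        (trans eq (+-cong (*-congˡ (sym x≈)) (-‿cong (*-congˡ (sym y≈)))))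
      go : Tri (v Fin.< i) (v ≡ i) (i Fin.< v) → Tri (j Fin.< i) (j ≡ i) (i Fin.< j) →
        ⟦ adj v j ⟧ * (u i v - u i j) ≈ typeOfMax i j * u i v - typeOfMax v i * u i j
      go (tri< v<i _ _) (tri< j<i _ _) =
        by ≡.refl (u-< v<i) (u-< j<i) (typeOfMax-≮ (ℕ.<-asym j<i)) (typeOfMax-< v<i)
          (solve 2 (λ a d → a :* (con (+ 1) :- con (+ 1)) := d :* con (+ 1) :- d :* con (+ 1)) refl _ _)
      go (tri< v<i _ _) (tri≈ _ ≡.refl _) =
        by (≡.cong ⟦_⟧ (adj-typeʳ v i v<i)) (u-< v<i) (u-≡ i) (typeOfMax-≮ (ℕ.<-irrefl ≡.refl)) (typeOfMax-< v<i)
          (solve 2 (λ d x → d :* (con (+ 1) :- :- x) := d :* con (+ 1) :- d :* :- x) refl _ _)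
      go (tri< v<i _ _) (tri> _ _ i<j) =
        by (≡.cong ⟦_⟧ (adj-typeʳ v j (ℕ.<-trans v<i i<j))) (u-< v<i) (u-> i<j) (typeOfMax-< i<j) ≡.refl
          (solve 2 (λ d m → d :* (con (+ 1) :- con (+ 0)) := d :* con (+ 1) :- m :* con (+ 0)) refl _ _)
      go (tri≈ _ ≡.refl _) (tri< j<i _ _) =
        by (≡.cong ⟦_⟧ (adj-type i j j<i)) (u-≡ i) (u-< j<i)
          (typeOfMax-≮ (ℕ.<-asym j<i)) (typeOfMax-≮ (ℕ.<-irrefl ≡.refl))
          (solve 2 (λ d x → d :* (:- x :- con (+ 1)) := d :* :- x :- d :* con (+ 1)) refl _ _)
      go (tri≈ _ ≡.refl _) (tri≈ _ ≡.refl _) =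
        by ≡.refl (u-≡ i) (u-≡ i) (typeOfMax-≮ (ℕ.<-irrefl ≡.refl)) (typeOfMax-≮ (ℕ.<-irrefl ≡.refl))
          (solve 3 (λ a d x → a :* (:- x :- :- x) := d :* :- x :- d :* :- x) refl _ _ _)
      go (tri≈ _ ≡.refl _) (tri> _ _ i<j) =
        by (≡.cong ⟦_⟧ (adj-typeʳ i j i<j)) (u-≡ i) (u-> i<j) (typeOfMax-< i<j) ≡.refl
          (solve 3 (λ d m x → d :* (:- x :- con (+ 0)) := d :* :- x :- m :* con (+ 0)) refl _ _ _)
      go (tri> _ _ i<v) (tri< j<i _ _) =
        by (≡.cong ⟦_⟧ (adj-type v j (ℕ.<-trans j<i i<v))) (u-> i<v) (u-< j<i) ≡.refl (typeOfMax-≮ (ℕ.<-asym i<v))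
          (solve 2 (λ d m → d :* (con (+ 0) :- con (+ 1)) := m :* con (+ 0) :- d :* con (+ 1)) refl _ _)
      go (tri> _ _ i<v) (tri≈ _ ≡.refl _) =
        by (≡.cong ⟦_⟧ (adj-type v i i<v)) (u-> i<v) (u-≡ i) ≡.refl (typeOfMax-≮ (ℕ.<-asym i<v))
          (solve 3 (λ d m x → d :* (con (+ 0) :- :- x) := m :* con (+ 0) :- d :* :- x) refl _ _ _)
      go (tri> _ _ i<v) (tri> _ _ i<j) =
        by ≡.refl (u-> i<v) (u-> i<j) ≡.refl ≡.refl
          (solve 3 (λ a d m → a :* (con (+ 0) :- con (+ 0)) := d :* con (+ 0) :- m :* con (+ 0)) refl _ _ _)

  u∈eigenspace : ∀ i → Eigenspace G (μ i) (u i)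
  u∈eigenspace i v = begin
    laplacian G v ∙ u i
      ≈⟨ laplacian-∙ v (u i) ⟩
    sum (λ j → ⟦ adj v j ⟧ * (u i v - u i j))
      ≈⟨ sum-cong-≋ (termwise i v) ⟩
    sum (λ j → typeOfMax i j * u i v - typeOfMax v i * u i j)
      ≈⟨ sum-sub (λ j → typeOfMax i j * u i v) (λ j → typeOfMax v i * u i j) ⟩
    sum (λ j → typeOfMax i j * u i v) - sum (λ j → typeOfMax v i * u i j)
      ≈⟨ +-cong (∑-*ʳ (u i v) (typeOfMax i))
                (-‿cong (trans (∑-*ˡ (typeOfMax v i) (u i)) (trans (*-congˡ (sum-u i)) (zeroʳ _)))) ⟩
    μ i * u i v - 0#
      ≈⟨ solve 1 (λ x → x :- con (+ 0) := x) refl (μ i * u i v) ⟩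
    μ i * u i v ∎

  0≤⟦_⟧ : ∀ b → 0# ≤ ⟦ b ⟧
  0≤⟦ true  ⟧ = 0≤1
  0≤⟦ false ⟧ = ≤-refl

  ⟦_⟧≤1 : ∀ b → ⟦ b ⟧ ≤ 1#
  ⟦ true  ⟧≤1 = ≤-refl
  ⟦ false ⟧≤1 = 0≤1

  -- The sum for `i` has entries 1 only at positions after `i`; there the later of `j` and `l` also
  -- comes after `i`, hence is dominating.
  μ-smallest : ∀ i → type i ≡ false → (∀ l → i Fin.< l → type l ≡ true) → ∀ j → μ i ≤ μ j
  μ-smallest i i-isolated later j = sum-mono lem
    where
    lem : ∀ l → typeOfMax i l ≤ typeOfMax j l
    lem l with i Fin.<? l
    ... | no  i≮l rewrite i-isolated = 0≤⟦ if ⌊ j Fin.<? l ⌋ then type l else type j ⟧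
    ... | yes i<l rewrite later l i<l with j Fin.<? l
    ...   | yes j<l = ≤-refl
    ...   | no  j≮l rewrite later j (ℕ.<-≤-trans i<l (ℕ.≮⇒≥ j≮l)) = ≤-refl

  -- After `i` everything is dominating, so all n terms of `μ v` are 1. For `v` up to `i` compare
  -- termwise: up to `j` the terms of `μ j` are 1, and beyond `j` the terms can differ only when the
  -- later vertex is `v` itself, which is then isolated.
  μ-second-largest : ∀ (i j : Fin n) → (∀ l → i Fin.< l → type l ≡ true) → type j ≡ true →
    (∀ l → j Fin.< l → l Fin.≤ i → type l ≡ false) → ∀ v → μ v ≤ μ j ⊎ μ v ≈ n · 1#
  μ-second-largest i j later j-dominating between v with i Fin.<? v
  ... | yes i<v = inj₂ (trans (sum-cong-≋ {n} {typeOfMax v} {λ _ → 1#} lem) (sum-1 n))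
    where
    lem : ∀ l → typeOfMax v l ≈ 1#
    lem l with v Fin.<? l
    ... | yes v<l rewrite later l (ℕ.<-trans i<v v<l) = refl
    ... | no  _   rewrite later v i<v = refl
  ... | no  i≮v = inj₁ (sum-mono lem)
    where
    v≤i : v Fin.≤ i
    v≤i = ℕ.≮⇒≥ i≮v
    lem : ∀ l → typeOfMax v l ≤ typeOfMax j l
    lem l with j Fin.<? l
    ... | no  _   rewrite j-dominating = ⟦ if ⌊ v Fin.<? l ⌋ then type l else type v ⟧≤1
    ... | yes j<l with v Fin.<? l
    ...   | yes _   = ≤-refl
    ...   | no  v≮l rewrite between v (ℕ.<-≤-trans j<l (ℕ.≮⇒≥ v≮l)) v≤i = 0≤⟦ type l ⟧

-- Locating the last isolated vertex and the last dominating vertex before it.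

last-such : ∀ {n} (Q : Fin n → Bool) i → Q i ≡ true →
  ∃[ j ] Q j ≡ true × (∀ l → j Fin.< l → Q l ≡ false) × i Fin.≤ j
last-such {suc n} Q i Qi with Fin.any? (λ l → Q (suc l) Bool.≟ true)
last-such {suc n} Q zero    Qi | yes (l , Ql) with last-such (Q ∘ suc) l Ql
... | j , Qj , later , _ = suc j , Qj , (λ { (suc l) (s≤s j<l) → later l j<l }) , z≤n
last-such {suc n} Q (suc i) Qi | yes _ with last-such (Q ∘ suc) i Qi
... | j , Qj , later , i≤j = suc j , Qj , (λ { (suc l) (s≤s j<l) → later l j<l }) , s≤s i≤j
last-such {suc n} Q zero    Qi | no none = zero , Qi , (λ { (suc l) _ → Bool.¬-not (λ Ql → none (l , Ql)) }) , z≤n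
last-such {suc n} Q (suc i) Qi | no none = ⊥-elim (none (i , Qi))

last-vertex : ∀ {n} → Fin n → Σ (Fin n) λ ℓ → ∀ (v : Fin n) → v Fin.≤ ℓ
last-vertex {suc n} _ = Fin.fromℕ n , Fin.≤fromℕ

predecessor : ∀ {n} (i j : Fin n) → i Fin.< j → Σ (Fin n) λ p → i Fin.≤ p × toℕ j ≡ suc (toℕ p)
predecessor zero    (suc j) _ = Fin.inject₁ j , z≤n , ≡.cong suc (≡.sym (Fin.toℕ-inject₁ j))
predecessor (suc i) (suc j) (s≤s i<j) with predecessor i j i<j
... | p , i≤p , eq = suc p , s≤s i≤p , ≡.cong suc eq

module LastRuns {n k : ℕ} (G : Graph n) (thr : Graph.IsThreshold G) (connected : Graph.Connected G)
                (splitting : IntervalSplitting G k) (2<k : 2 ℕ.< k) where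
  open Graph G
  open ThresholdType G thr
  open IntervalSplitting splitting

  sameType : ∀ i j → type i ≡ type j → SameType i j
  sameType i j eq with thr i | thr j
  ... | inj₁ p | inj₁ q = inj₁ (p , q)
  ... | inj₂ p | inj₂ q = inj₂ (p , q)
  sameType i j () | inj₁ _ | inj₂ _
  sameType i j () | inj₂ _ | inj₁ _

  -- Walking back from `j`, a constant type would carry the interval of `j` all the way to `i` by
  -- the run condition. That condition says nothing about the first vertex, hence the bound on `i`.
  type-changes : ∀ i j → 1 ℕ.≤ toℕ i → i Fin.≤ j → interval i ≢ interval j →
    ∃[ w ] i Fin.< w × w Fin.≤ j × type w ≢ type i
  type-changes i j 1≤i i≤j = go (toℕ j) j ≡.refl i≤j
    where
    go : ∀ m j → toℕ j ≡ m → i Fin.≤ j → interval i ≢ interval j →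
      ∃[ w ] i Fin.< w × w Fin.≤ j × type w ≢ type i
    go m j j≡m i≤j different with toℕ i ℕ.≟ toℕ j
    ... | yes i≡j = ⊥-elim (different (≡.cong interval (Fin.toℕ-injective i≡j)))
    ... | no  i≢j with type j Bool.≟ type i
    ...   | no  types≢ = j , ℕ.≤∧≢⇒< i≤j i≢j , ℕ.≤-refl , types≢
    ...   | yes types≡ with predecessor i j (ℕ.≤∧≢⇒< i≤j i≢j)
    go zero    j j≡0   i≤j different | no _ | yes _      | p , _   , j≡1+p with () ← ≡.trans (≡.sym j≡0) j≡1+p
    go (suc m) j j≡1+m i≤j different | no _ | yes types≡ | p , i≤p , j≡1+p with interval p Fin.≟ interval j
    ... | yes same =
      let w , i<w , w≤p , types≢ = go m p (ℕ.suc-injective (≡.trans (≡.sym j≡1+p) j≡1+m)) i≤p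
                                     (λ eq → different (≡.trans eq same))
      in w , i<w , ℕ.≤-trans w≤p (ℕ.<⇒≤ (ℕ.≤-reflexive (≡.sym j≡1+p))) , types≢
    ... | no  intervals≢ =
        p , ℕ.≤∧≢⇒< i≤p (λ i≡p → p-differs (≡.cong type (≡.sym (Fin.toℕ-injective i≡p))))
      , ℕ.<⇒≤ (ℕ.≤-reflexive (≡.sym j≡1+p)) , p-differs
      where
      p-differs : type p ≢ type i
      p-differs eq = intervals≢ (Equivalence.from (runs p j (ℕ.≤-trans 1≤i i≤p) j≡1+p)
        (sameType p j (≡.trans eq (≡.sym types≡))))

  interval<⇒< : ∀ i j → interval i Fin.< interval j → i Fin.< j
  interval<⇒< i j p = ℕ.≰⇒> (λ j≤i → ℕ.<⇒≱ p (monotone j i j≤i))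

  ∃-interval : ∀ m → m ℕ.≤ k → ∃[ i ] toℕ (interval i) ≡ m
  ∃-interval m m≤k with nonempty (Fin.fromℕ< (s≤s m≤k))
  ... | i , eq = i , ≡.trans (≡.cong toℕ eq) (Fin.toℕ-fromℕ< (s≤s m≤k))

  -- Representatives of the intervals k - 2 and k - 1 and the last vertex avoid the first interval
  -- because k > 2. Whatever the types of the first two, a type change up to the next one supplies
  -- what is missing.
  dominating-before-isolated : ∃[ i ] ∃[ j ] type i ≡ false × type j ≡ true × 1 ℕ.≤ toℕ j × j Fin.< i
  dominating-before-isolated = go (type y) ≡.refl (type x) ≡.refl
    where
    1≤k∸2 : 1 ℕ.≤ k ℕ.∸ 2
    1≤k∸2 = ℕ.m<n⇒0<n∸m 2<k
    k∸2<k∸1 : k ℕ.∸ 2 ℕ.< k ℕ.∸ 1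
    k∸2<k∸1 = ℕ.∸-monoʳ-< ℕ.≤-refl (ℕ.<⇒≤ 2<k)
    k∸1<k : k ℕ.∸ 1 ℕ.< k
    k∸1<k = ℕ.∸-monoʳ-< ℕ.z<s (ℕ.≤-trans (s≤s z≤n) 2<k)
    x∈ = ∃-interval (k ℕ.∸ 2) (ℕ.m∸n≤m k 2)
    y∈ = ∃-interval (k ℕ.∸ 1) (ℕ.m∸n≤m k 1)
    z∈ = ∃-interval k ℕ.≤-refl
    x = proj₁ x∈
    y = proj₁ y∈
    z = proj₁ z∈
    ℓ = proj₁ (last-vertex x)
    ≤ℓ = proj₂ (last-vertex x)
    x<y-interval : interval x Fin.< interval y
    x<y-interval = ≡.subst₂ ℕ._<_ (≡.sym (proj₂ x∈)) (≡.sym (proj₂ y∈)) k∸2<k∸1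
    x<y : x Fin.< y
    x<y = interval<⇒< x y x<y-interval
    y<ℓ-interval : interval y Fin.< interval ℓ
    y<ℓ-interval = ℕ.<-≤-trans (≡.subst₂ ℕ._<_ (≡.sym (proj₂ y∈)) (≡.sym (proj₂ z∈)) k∸1<k)
      (monotone z ℓ (≤ℓ z))
    y<ℓ : y Fin.< ℓ
    y<ℓ = interval<⇒< y ℓ y<ℓ-interval
    1≤x : 1 ℕ.≤ toℕ x
    1≤x = ℕ.n≢0⇒n>0 (λ x≡0 → ℕ.<⇒≢ 1≤k∸2 (≡.sym (≡.trans (≡.sym (proj₂ x∈))
      (≡.cong toℕ (Equivalence.from (first x) x≡0)))))
    1≤y : 1 ℕ.≤ toℕ y
    1≤y = ℕ.≤-trans 1≤x (ℕ.<⇒≤ x<y)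
    ℓ-dominating : type ℓ ≡ true
    ℓ-dominating = edge  (connected ℓ y) ≡.refl
      where
      edge : ∀ {a} → Star (λ u v → adj u v ≡ true) a y → a ≡ ℓ → type ℓ ≡ true
      edge stop y≡ℓ = ⊥-elim (ℕ.<⇒≢ y<ℓ (≡.cong toℕ y≡ℓ))
      -- A path away from the last vertex starts with an edge to an earlier vertex, which an
      -- isolated vertex does not have.
      edge (_◅_ {j = w} ℓw _) ≡.refl = ≡.trans (≡.sym (adj-type ℓ w (ℕ.≤∧≢⇒< (≤ℓ w) w≢ℓ))) ℓw
        where
        w≢ℓ : toℕ w ≢ toℕ ℓ
        w≢ℓ eq with ≡.trans (≡.sym (irrefl ℓ)) (≡.trans (≡.cong (adj ℓ) (Fin.toℕ-injective (≡.sym eq))) ℓw)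
        ... | ()
    go : ∀ a → type y ≡ a → ∀ c → type x ≡ c →
      ∃[ i ] ∃[ j ] type i ≡ false × type j ≡ true × 1 ℕ.≤ toℕ j × j Fin.< i
    go true  y-dom c     _ =
      let w , y<w , _ , types≢ = type-changes y ℓ 1≤y (ℕ.<⇒≤ y<ℓ) (Fin.<⇒≢ y<ℓ-interval)
      in w , y , Bool.¬-not (λ w-dom → types≢ (≡.trans w-dom (≡.sym y-dom))) , y-dom , 1≤y , y<w
    go false y-iso true  x-dom = y , x , y-iso , x-dom , 1≤x , x<y
    go false y-iso false x-iso =
      let w , x<w , w≤y , types≢ = type-changes x y 1≤x (ℕ.<⇒≤ x<y) (Fin.<⇒≢ x<y-interval)
          w-dom = ≡.trans (Bool.¬-not types≢) (≡.cong not x-iso)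
      in y , w , y-iso , w-dom , ℕ.≤-trans 1≤x (ℕ.<⇒≤ x<w)
       , ℕ.≤∧≢⇒< w≤y (λ w≡y →
           true≢false (≡.trans (≡.sym w-dom) (≡.trans (≡.cong type (Fin.toℕ-injective w≡y)) y-iso)))

  record LastIsolatedAndDominating : Set where
    field
      i₀ j₀       : Fin n
      i₀-isolated : type i₀ ≡ false
      later       : ∀ l → i₀ Fin.< l → type l ≡ true
      j₀-dominating : type j₀ ≡ true
      1≤j₀        : 1 ℕ.≤ toℕ j₀
      j₀<i₀       : j₀ Fin.< i₀
      between     : ∀ l → j₀ Fin.< l → l Fin.≤ i₀ → type l ≡ false

  lastIsolatedAndDominating : LastIsolatedAndDominating
  lastIsolatedAndDominating with dominating-before-isolated
  ... | i , j , i-iso , j-dom , 1≤j , j<i with last-such (not ∘ type) i (≡.cong not i-iso)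
  ...   | i₀ , i₀-iso , later , i≤i₀ with last-such (λ l → type l ∧ ⌊ l Fin.<? i₀ ⌋) j j-candidate
    where
    j-candidate : type j ∧ ⌊ j Fin.<? i₀ ⌋ ≡ true
    j-candidate rewrite j-dom with j Fin.<? i₀
    ... | yes _    = ≡.refl
    ... | no  j≮i₀ = ⊥-elim (j≮i₀ (ℕ.<-≤-trans j<i i≤i₀))
  ...     | j₀ , j₀-cand , j₀-last , j≤j₀ = record
    { i₀ = i₀
    ; j₀ = j₀
    ; i₀-isolated = i₀-isolated
    ; later = λ l i₀<l → ≡.trans (≡.sym (Bool.not-involutive (type l))) (≡.cong not (later l i₀<l))
    ; j₀-dominating = proj₁ (split j₀ j₀-cand)
    ; 1≤j₀ = ℕ.≤-trans 1≤j j≤j₀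
    ; j₀<i₀ = proj₂ (split j₀ j₀-cand)
    ; between = between
    }
    where
    i₀-isolated : type i₀ ≡ false
    i₀-isolated = ≡.trans (≡.sym (Bool.not-involutive (type i₀))) (≡.cong not i₀-iso)
    split : ∀ l → type l ∧ ⌊ l Fin.<? i₀ ⌋ ≡ true → type l ≡ true × l Fin.< i₀
    split l p with type l | l Fin.<? i₀
    ... | true | yes l<i₀ = ≡.refl , l<i₀
    between : ∀ l → j₀ Fin.< l → l Fin.≤ i₀ → type l ≡ false
    between l j₀<l l≤i₀ with toℕ l ℕ.≟ toℕ i₀
    ... | yes l≡i₀ = ≡.trans (≡.cong type (Fin.toℕ-injective l≡i₀)) i₀-isolated
    ... | no  l≢i₀ with j₀-last l j₀<l
    ...   | p with type l | l Fin.<? i₀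
    ...     | false | _        = ≡.refl
    ...     | true  | yes _    with () ← p
    ...     | true  | no  l≮i₀ = ⊥-elim (l≮i₀ (ℕ.≤∧≢⇒< l≤i₀ l≢i₀))

-- The eigenpolytope, its faces, and designs of a threshold graph.

module ThresholdDesigns {c ℓ₁ ℓ₂ : Level} (𝕂 : OrderedField c ℓ₁ ℓ₂) {n k t β : ℕ} (G : Graph n)
    (thr : Graph.IsThreshold G) (connected : Graph.Connected G)
    (splitting : IntervalSplitting G k) (2<k : 2 ℕ.< k) (1≤t : 1 ℕ.≤ t) (t+2≤k : t ℕ.+ 2 ℕ.≤ k)
    (S : Eigenpolytopes.Spectrum 𝕂 G k)
    (B : Vector (Eigenpolytopes.Vec 𝕂 n) β) (B-basis : Eigenpolytopes.IsEigenbasisMatrix 𝕂 S t B) where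
  open OrderedFieldProperties 𝕂
  open WeightedSums 𝕂
  open ConvexGeometry 𝕂
  open AveragingConfigurations 𝕂
  open Eigenpolytopes 𝕂
  open Designs S t
  open LaplacianProperties 𝕂 G
  open OrthogonalBasis 𝕂 {n}
  open ThresholdType G thr
  open ThresholdSpectrum 𝕂 G thr
  open LastRuns G thr connected splitting 2<k
  open Spectrum S
  open IsEigenbasisMatrix B-basis
  open LastIsolatedAndDominating lastIsolatedAndDominating

  b : Vector (Vec β) n
  b = columns B

  eigenspace-≈ : ∀ {μ ν f} → μ ≈ ν → Eigenspace G μ f → Eigenspace G ν f
  eigenspace-≈ μ≈ν f∈ v = trans (f∈ v) (*-congʳ μ≈ν)

  eigenspace-≋ : ∀ {μ f g} → f ≋ g → Eigenspace G μ f → Eigenspace G μ g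
  eigenspace-≋ f≋g f∈ v = trans (∙-congʳ (laplacian G v) (λ j → sym (f≋g j))) (trans (f∈ v) (*-congˡ (f≋g v)))

  eigenvalue-injective : ∀ {i j} → i ≢ j → ¬ (eigenvalue i ≈ eigenvalue j)
  eigenvalue-injective {i} {j} i≢j with Fin.<-cmp i j
  ... | tri< i<j _ _ = <⇒≉ (increasing i j i<j)
  ... | tri≈ _ i≡j _ = ⊥-elim (i≢j i≡j)
  ... | tri> _ _ j<i = λ p → <⇒≉ (increasing j i j<i) (sym p)

  locate : ∀ i → 1 ℕ.≤ toℕ i → ∃[ m ] μ i ≈ eigenvalue m
  locate i 1≤i = Equivalence.to (exhaustive (μ i))
    (u i , u∈eigenspace i , λ u≋0 → 0<⇒≉0 (0<‖u‖² i 1≤i) (sum-zero (λ j → trans (*-congʳ (u≋0 j)) (zeroˡ _))))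

  LevelOf : Fin n → Fin (suc k) → Set _
  LevelOf i m = (toℕ i ≡ 0 → m ≡ zero) × (1 ℕ.≤ toℕ i → μ i ≈ eigenvalue m) × E m (u i)

  abstract
    level-spec : ∀ i → ∃[ m ] LevelOf i m
    level-spec i = go (1 ℕ.≤? toℕ i)
      where
      go : Dec (1 ℕ.≤ toℕ i) → ∃[ m ] LevelOf i m
      -- The zero vector lies in every eigenspace; choosing level 0 by default keeps the first
      -- vertex from being high.
      go (no  1≰i) = zero , (λ _ → ≡.refl) , (λ 1≤i → ⊥-elim (1≰i 1≤i))
                   , eigenspace-zero _ (u-first i (ℕ.n<1⇒n≡0 (ℕ.≰⇒> 1≰i)))
      go (yes 1≤i) = let m , μ≈ = locate i 1≤i in
        m , (λ i≡0 → ⊥-elim (ℕ.<⇒≢ 1≤i (≡.sym i≡0))) , (λ _ → μ≈) , eigenspace-≈ μ≈ (u∈eigenspace i)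

  level : Fin n → Fin (suc k)
  level i = proj₁ (level-spec i)

  level-first : ∀ i → toℕ i ≡ 0 → level i ≡ zero
  level-first i = proj₁ (proj₂ (level-spec i))

  μ≈eigenvalue : ∀ i → 1 ℕ.≤ toℕ i → μ i ≈ eigenvalue (level i)
  μ≈eigenvalue i = proj₁ (proj₂ (proj₂ (level-spec i)))

  u∈E : ∀ i → E (level i) (u i)
  u∈E i = proj₂ (proj₂ (proj₂ (level-spec i)))

  -- An eigenvector whose nonzero eigenvalue differs from every `μ j` would be orthogonal to the
  -- constants and to all `u j`, hence zero.
  eigenvalue⇒μ : ∀ m → 0 ℕ.< toℕ m → ∃[ j ] eigenvalue m ≈ μ j
  eigenvalue⇒μ m 0<m with Fin.any? (λ j → eigenvalue m ≟ μ j)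
  ... | yes p    = p
  ... | no  none with Equivalence.from (exhaustive (eigenvalue m)) (m , refl)
  ...   | f , f∈E , f≉0 = ⊥-elim (f≉0 (complete f
        (trans (sum-cong-≋ (λ v → sym (*-identityʳ (f v))))
          (eigenspaces-orthogonal {eigenvalue m} {0#} {f} {λ _ → 1#}
             (λ p → <⇒≉ (increasing zero m 0<m) (trans zeroth (sym p))) f∈E (constant∈kernel 1#)))
        (λ i → eigenspaces-orthogonal {μ i} {eigenvalue m} {u i} {f}
          (λ p → none (i , sym p)) (u∈eigenspace i) f∈E)))

  -- Since λ₁ is some `μ j`, minimality of `μ i₀` forbids a level above 1, and 1 ≤ t.
  level-i₀ : toℕ (level i₀) ℕ.≤ t
  level-i₀ = ℕ.≤-trans (ℕ.≮⇒≥ λ 1<level →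
      let one = Fin.fromℕ< (s≤s (ℕ.≤-trans (s≤s z≤n) 2<k))
          one≡1 = Fin.toℕ-fromℕ< (s≤s (ℕ.≤-trans (s≤s z≤n) 2<k))
          j , λ₁≈μj = eigenvalue⇒μ one (≡.subst (0 ℕ.<_) (≡.sym one≡1) (s≤s z≤n))
      in <⇒≱ (increasing one (level i₀) (≡.subst (ℕ._< toℕ (level i₀)) (≡.sym one≡1) 1<level))
           (≤-respˡ-≈ (μ≈eigenvalue i₀ (ℕ.<-trans 1≤j₀ j₀<i₀)) (≤-respʳ-≈ (sym λ₁≈μj)
             (μ-smallest i₀ i₀-isolated later j)))) 1≤t

  -- Otherwise every eigenvalue above level t exceeds `μ j₀` and so equals n; but levels t + 1 and t
  -- + 2 both exist and have different eigenvalues.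
  level-j₀ : t ℕ.< toℕ (level j₀)
  level-j₀ = ℕ.≰⇒> λ level≤t →
    let large : ∀ m → t ℕ.< toℕ m → eigenvalue m ≈ n · 1#
        large m t<m =
          let v , λm≈μv = eigenvalue⇒μ m (ℕ.≤-trans (s≤s z≤n) t<m)
              μj₀<λm = <-respˡ-≈ (sym (μ≈eigenvalue j₀ 1≤j₀))
                         (increasing (level j₀) m (ℕ.≤-<-trans level≤t t<m))
          in dichotomy λm≈μv μj₀<λm (μ-second-largest i₀ j₀ later j₀-dominating between v)
    in <⇒≉ (increasing (Fin.fromℕ< t+1<1+k) (Fin.fromℕ< t+2<1+k)
             (≡.subst₂ ℕ._<_ (≡.sym (Fin.toℕ-fromℕ< t+1<1+k)) (≡.sym (Fin.toℕ-fromℕ< t+2<1+k)) ℕ.≤-refl))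
         (trans (large _ (≡.subst (t ℕ.<_) (≡.sym (Fin.toℕ-fromℕ< t+1<1+k)) ℕ.≤-refl))
           (sym (large _ (≡.subst (t ℕ.<_) (≡.sym (Fin.toℕ-fromℕ< t+2<1+k)) (ℕ.m<n⇒m<1+n ℕ.≤-refl)))))
    where
    t+2<1+k : 2 ℕ.+ t ℕ.< suc k
    t+2<1+k = s≤s (≡.subst (ℕ._≤ k) (ℕ.+-comm t 2) t+2≤k)
    t+1<1+k : 1 ℕ.+ t ℕ.< suc k
    t+1<1+k = ℕ.<⇒≤ t+2<1+k
    dichotomy : ∀ {m v} → eigenvalue m ≈ μ v → μ j₀ < eigenvalue m → μ v ≤ μ j₀ ⊎ μ v ≈ n · 1# →
      eigenvalue m ≈ n · 1#
    dichotomy λ≈μ μj₀<λ (inj₁ μ≤) = ⊥-elim (<⇒≱ μj₀<λ (≤-respˡ-≈ (sym λ≈μ) μ≤))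
    dichotomy λ≈μ μj₀<λ (inj₂ μ≈n) = trans λ≈μ μ≈n

  high : Fin n → Bool
  high v = ⌊ t ℕ.<? toℕ (level v) ⌋

  V : Fin n → Bool
  V v = isFirst v ∨ high v

  ∉V⇒ : ∀ v → V v ≡ false → isFirst v ≡ false × high v ≡ false
  ∉V⇒ v = ∨-false {isFirst v}

  first∈V : ∀ v → toℕ v ≡ 0 → V v ≡ true
  first∈V v p = ≡.cong (_∨ high v) (≡0⇒isFirst v p)

  high⇒V : ∀ v → high v ≡ true → V v ≡ true
  high⇒V v p = ≡.trans (≡.cong (isFirst v ∨_) p) (Bool.∨-zeroʳ (isFirst v))

  high-first : ∀ v → toℕ v ≡ 0 → high v ≡ false
  high-first v p = ⌊⌋-false (t ℕ.<? toℕ (level v)) λ t<level →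
    ℕ.n≮0 (≡.subst (t ℕ.<_) (≡.cong toℕ (level-first v p)) t<level)

  open Barycentric V first∈V

  abstract
    o : Fin n
    o = Fin.fromℕ< (ℕ.≤-<-trans z≤n (Fin.toℕ<n i₀))

    o≡0 : toℕ o ≡ 0
    o≡0 = Fin.toℕ-fromℕ< _

  o< : ∀ v → V v ≡ false → o Fin.< v
  o< v v∉V = ≡.subst (ℕ._< toℕ v) (≡.sym o≡0) (¬isFirst⇒1≤ v (proj₁ (∉V⇒ v v∉V)))

  i₀-low : high i₀ ≡ false
  i₀-low = ⌊⌋-false (t ℕ.<? toℕ (level i₀)) (ℕ.≤⇒≯ level-i₀)

  j₀-high : high j₀ ≡ true
  j₀-high = ⌊⌋-true (t ℕ.<? toℕ (level j₀)) level-j₀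

  low⇒∉V : ∀ v → isFirst v ≡ false → high v ≡ false → V v ≡ false
  low⇒∉V v p q = ≡.cong₂ _∨_ p q

  i₀∉V : V i₀ ≡ false
  i₀∉V = low⇒∉V i₀ (1≤⇒¬isFirst i₀ (ℕ.<-trans 1≤j₀ j₀<i₀)) i₀-low

  outside-level : ∀ v → V v ≡ false → toℕ (level v) ℕ.≤ t
  outside-level v v∉V = ℕ.≮⇒≥ (false-⌊⌋ (t ℕ.<? toℕ (level v)) (proj₂ (∉V⇒ v v∉V)))

  orthogonal⇒averages : ∀ {φ} → (∀ i → V i ≡ false → u i ∙ φ ≈ 0#) → AveragesOff V φ
  orthogonal⇒averages {φ} φ⊥ i i∉V = sym (x-y≈0⇒x≈y (trans (sym (u-∙ i φ)) (φ⊥ i i∉V)))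

  averages⇒orthogonal : ∀ {φ} → AveragesOff V φ → ∀ i → V i ≡ false → u i ∙ φ ≈ 0#
  averages⇒orthogonal {φ} φ-avg i i∉V = trans (u-∙ i φ) (x≈y⇒x-y≈0 (sym (φ-avg i i∉V)))

  B∈E : ∀ r → E (block r) (B r)
  B∈E r = IsBasisOn.members (basis (block r) (above r)) r ≡.refl

  b-averages : ∀ r → AveragesOff V (λ v → b v r)
  b-averages r = orthogonal⇒averages λ i i∉V →
    eigenspaces-orthogonal {eigenvalue (level i)} {eigenvalue (block r)} {u i} {B r}
      (eigenvalue-injective (λ p → ℕ.<⇒≢ (ℕ.≤-<-trans (outside-level i i∉V) (above r)) (≡.cong toℕ p)))
      (u∈E i) (B∈E r)

  -- In the orthogonal expansion the first term is zero with its `u`, the other low coefficients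
  -- vanish by the averaging rule, and each high `u i` is a combination of rows of `B`. The mean
  -- supplies the constant term.
  affine : ∀ φ → AveragesOff V φ → Affine b φ
  affine φ φ-avg = linComb (coefficient φ) w , mean φ , λ v → trans (expansion φ v) (+-congʳ (begin
      linComb (coefficient φ) u v                              ≈⟨ sum-cong-≋ (λ i → proj₂ (rows i) v) ⟩
      linComb (coefficient φ) (λ i → linComb (w i) B) v        ≈⟨ linComb-linComb (coefficient φ) w B v ⟩
      linComb (linComb (coefficient φ) w) B v                  ∎))
    where
    Row : Fin n → Set _
    Row i = ∃[ w ] ∀ v → coefficient φ i * u i v ≈ coefficient φ i * linComb w B v
    rows : ∀ i → Row i
    rows i = bool-cases (high i)
      (λ i-high →
        let w , _ , u≋ = IsBasisOn.spanning (basis (level i) (true-⌊⌋ (t ℕ.<? toℕ (level i)) i-high)) (u i) (u∈E i)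
        in w , λ v → *-congˡ (u≋ v))
      (λ i-low → 𝟎 , λ v → trans (vanishes i i-low v)
        (sym (trans (*-congˡ (sum-zero (λ r → zeroˡ (B r v)))) (zeroʳ _))))
      where
      vanishes : ∀ i → high i ≡ false → ∀ v → coefficient φ i * u i v ≈ 0#
      vanishes i i-low v = bool-cases (isFirst i)
        (λ i-first → trans (*-congˡ (u-first i (isFirst⇒≡0 i i-first) v)) (zeroʳ _))
        (λ i-not-first → trans (*-congʳ (trans
           (*-congˡ (averages⇒orthogonal φ-avg i (low⇒∉V i i-not-first i-low))) (zeroʳ _))) (zeroˡ _))
    w : Fin n → Vec β
    w i = proj₁ (rows i)

  eigenvector⇒lowSum : ∀ m {f} → toℕ m ℕ.≤ t → E m f → LowSum t f
  eigenvector⇒lowSum m {f} m≤t f∈E =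
      (λ i v → δ m i * f v)
    , component
    , (λ i t<i v → trans
        (*-congʳ (reflexive (δ-≢ λ m≡i → ℕ.<⇒≱ t<i (≡.subst (λ l → toℕ l ℕ.≤ t) m≡i m≤t)))) (zeroˡ _))
    , (λ v → sym (sum-δ m (λ _ → f v)))
    where
    component : ∀ i → E i (λ v → δ m i * f v)
    component i with m Fin.≟ i
    ... | yes ≡.refl = eigenspace-≋ (λ v → sym (trans (*-congʳ (reflexive (δ-refl m))) (*-identityˡ _))) f∈E
    ... | no  m≢i    = eigenspace-zero _ (λ v → trans (*-congʳ (reflexive (δ-≢ m≢i))) (zeroˡ _))

  u∈lowSum : ∀ i → V i ≡ false → LowSum t (u i)
  u∈lowSum i i∉V = eigenvector⇒lowSum (level i) (outside-level i i∉V) (u∈E i)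

  constant∈lowSum : LowSum t (λ _ → 1#)
  constant∈lowSum = eigenvector⇒lowSum zero z≤n (eigenspace-≈ (sym zeroth) (constant∈kernel 1#))

  -- Orthogonality of the eigenspaces read columnwise: functions in the low eigenspaces are linear
  -- dependences among the points of the configuration.
  lowSum-annihilates : ∀ {f} → LowSum t f → linComb f b ≋ 𝟎
  lowSum-annihilates {f} (g , g∈E , g-high , f≈) r = begin
    sum (λ v → f v * B r v)
      ≈⟨ sum-cong-≋ (λ v → trans (*-congʳ (f≈ v)) (*-distribʳ-sum (B r v) (λ i → g i v))) ⟩
    sum (λ v → sum (λ i → g i v * B r v))
      ≈⟨ ∑-comm (λ v i → g i v * B r v) ⟩
    sum (λ i → g i ∙ B r)
      ≈⟨ sum-zero g⊥B ⟩
    0# ∎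
    where
    g⊥B : ∀ i → g i ∙ B r ≈ 0#
    g⊥B i with t ℕ.<? toℕ i
    ... | yes t<i = sum-zero (λ v → trans (*-congʳ (g-high i t<i v)) (zeroˡ _))
    ... | no  t≮i = eigenspaces-orthogonal {eigenvalue i} {eigenvalue (block r)} {g i} {B r}
      (eigenvalue-injective (λ p → t≮i (≡.subst (λ l → t ℕ.< toℕ l) (≡.sym p) (above r)))) (g∈E i) (B∈E r)

  weight : Subset n → Vec n → Vec n
  weight W a v = if lookup W v then a v else 0#

  weight-* : ∀ W (a f : Vec n) v → (if lookup W v then a v * f v else 0#) ≈ f v * weight W a v
  weight-* W a f v with lookup W v
  ... | true  = *-comm (a v) (f v)
  ... | false = sym (zeroʳ (f v))

  design⇒sum : ∀ {W a f} → IsDesign W a → LowSum t f → f ∙ weight W a ≈ (n · 1#) ⁻¹ * sum f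
  design⇒sum {W} {a} {f} W-design f-low = sym (trans (W-design f f-low) (sum-cong-≋ (weight-* W a f)))

  -- The design is tested against the low `u i`, whose mean is zero; what remains is orthogonality
  -- of the weight to `u i`.
  design⇒averages : ∀ W a → IsDesign W a → AveragesOff V (weight W a)
  design⇒averages W a W-design = orthogonal⇒averages λ i i∉V →
    trans (design⇒sum {W} {a} W-design (u∈lowSum i i∉V)) (trans (*-congˡ (sum-u i)) (zeroʳ _))

  design⇒sum-weight : ∀ W a → IsDesign W a → sum (weight W a) ≈ 1#
  design⇒sum-weight W a W-design = begin
    sum (weight W a)                      ≈⟨ sum-cong-≋ (λ v → sym (*-identityˡ (weight W a v))) ⟩
    (λ _ → 1#) ∙ weight W a               ≈⟨ design⇒sum {W} {a} W-design constant∈lowSum ⟩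
    (n · 1#) ⁻¹ * sum {n} (λ _ → 1#)      ≈⟨ *-congˡ (sum-1 n) ⟩
    (n · 1#) ⁻¹ * (n · 1#)                ≈⟨ *-comm _ _ ⟩
    (n · 1#) * (n · 1#) ⁻¹                ≈⟨ *-inverseʳ (0<⇒≉0 (0<n o)) ⟩
    1#                                    ∎

  uniform-weight : ∀ W α → 0# < α → ∀ v →
    (lookup W v ≡ true × weight W (λ _ → α) v ≡ α) ⊎ (lookup W v ≡ false × weight W (λ _ → α) v ≡ 0#)
  uniform-weight W α 0<α v with lookup W v
  ... | true  = inj₁ (≡.refl , ≡.refl)
  ... | false = inj₂ (≡.refl , ≡.refl)

  0≤α-weight : ∀ W {α} → 0# < α → ∀ v → 0# ≤ α - weight W (λ _ → α) v
  0≤α-weight W 0<α v with lookup W v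
  ... | true  = inj₂ (sym (-‿inverseʳ _))
  ... | false = x≤y⇒0≤y-x (inj₁ 0<α)

  open AveragingConfiguration b V first∈V b-averages affine

  P-simplex : IsSimplex (conv b)
  P-simplex = isSimplex (count-first high o high-first)

  interior : Fin n → Bool
  interior v = isFirst v ∨ (high v ∧ ⌊ v Fin.<? i₀ ⌋)

  interior⊆V : ∀ v → V v ≡ false → interior v ≡ false
  interior⊆V v v∉V = ≡.cong₂ _∨_ (proj₁ (∉V⇒ v v∉V)) (≡.cong (_∧ ⌊ v Fin.<? i₀ ⌋) (proj₂ (∉V⇒ v v∉V)))

  interior-outside : ∀ q → interior q ≡ false → V q ≡ true → i₀ Fin.≤ q
  interior-outside q p q∈V = ℕ.≮⇒≥ λ q<i₀ → true≢false (≡.trans (≡.sym q∈V)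
    (low⇒∉V q (proj₁ split) (≡.trans (≡.sym (Bool.∧-identityʳ (high q)))
      (≡.trans (≡.cong (high q ∧_) (≡.sym (⌊⌋-true (q Fin.<? i₀) q<i₀))) (proj₂ split)))))
    where
    split : isFirst q ≡ false × high q ∧ ⌊ q Fin.<? i₀ ⌋ ≡ false
    split = ∨-false {isFirst q} p

  interior-inside : ∀ q → interior q ≡ true → V q ≡ true × q Fin.< i₀
  interior-inside q p = bool-cases (isFirst q)
    (λ q-first → ≡.cong (_∨ high q) q-first
               , ≡.subst (ℕ._< toℕ i₀) (≡.sym (isFirst⇒≡0 q q-first)) (ℕ.<-trans 1≤j₀ j₀<i₀))
    (λ q-not-first →
       let q-high , q<i₀ = ∧-true (≡.trans (≡.cong (_∨ (high q ∧ ⌊ q Fin.<? i₀ ⌋)) (≡.sym q-not-first)) p)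
       in high⇒V q q-high , true-⌊⌋ (q Fin.<? i₀) q<i₀)

  Region : Set _
  Region = Pred (Vec β) (c ⊔ ℓ₁ ⊔ ℓ₂)

  -- The coordinates of `b i₀` vanish beyond `i₀` because averages look backwards, and are positive
  -- at each vertex of `V` before `i₀`, whose unit enters the average. The vertex `j₀` makes the
  -- dimension at least 1.
  interior-face : Σ Region λ F → IsInteriorFace b F
  interior-face =
      Hull interior
    , (let a , γ , cut , _ = face interior interior⊆V in a , 1# - γ , cut)
    , (suc (proj₁ nonempty′) , s≤s z≤n
      , dimension interior interior⊆V
          (≡.trans (count-first _ o (λ v v≡0 → ≡.cong (_∧ ⌊ v Fin.<? i₀ ⌋) (high-first v v≡0)))
                   (≡.cong suc (proj₂ nonempty′))))
    , (i₀ , relative-interior interior interior⊆V i₀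
        (λ q q∉U → bool-cases (V q)
          (λ q∈V → bary-before q i₀ (ℕ.≤∧≢⇒< (interior-outside q q∉U q∈V) (λ i₀≡q →
             true≢false (≡.trans (≡.sym q∈V) (≡.trans (≡.cong V (≡.sym (Fin.toℕ-injective i₀≡q))) i₀∉V)))))
          (λ q∉V → bary-outside q i₀ q∉V))
        (λ q q∈U → let q∈V , q<i₀ = interior-inside q q∈U in
          averagesOff-pos (bary-averages q) (0≤bary q) i₀ i₀∉V q q<i₀
            (<-respʳ-≈ (sym (trans (bary-on q q q∈V) (reflexive (δ-refl q)))) 0<1)))
    where
    nonempty′ = count-suc (λ v → high v ∧ ⌊ v Fin.<? i₀ ⌋) j₀
      (≡.cong₂ _∧_ j₀-high (⌊⌋-true (j₀ Fin.<? i₀) j₀<i₀))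

  uniform-designs-contain-all-or-none : ∀ (F : Region) → IsInteriorFace b F → ∀ W → UniformDesign W →
    (∀ i → F (b i) → i ∈ W) ⊎ (∀ i → F (b i) → i ∉ W)
  uniform-designs-contain-all-or-none F ((_ , _ , _ , F⊆ , _) , _ , (i , i-interior)) W (α , 0<α , W-design) =
    conclude (uniform-weight W α 0<α i)
    where
    ψ : Vec n
    ψ = weight W (λ _ → α)
    ψ-averages : AveragesOff V ψ
    ψ-averages = design⇒averages W (λ _ → α) W-design
    0≤ψ : ∀ v → 0# ≤ ψ v
    0≤ψ v with lookup W v
    ... | true  = inj₁ 0<α
    ... | false = ≤-refl
    conclude : (lookup W i ≡ true × ψ i ≡ α) ⊎ (lookup W i ≡ false × ψ i ≡ 0#) → _
    -- Of the nonnegative affine functions α - ψ and ψ, the one vanishing at the interior point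
    -- vanishes on the whole face.
    conclude (inj₁ (_ , ψi≡α)) = inj₁ λ v Fv →
      inside v (zero-on-relative-interior {b = b} {F} (λ Fx → proj₁ (F⊆ Fx))
        (affine (λ v → α - ψ v) (averagesOff-sub (averagesOff-const α) ψ-averages)) (0≤α-weight W 0<α) i i-interior
        (x≈y⇒x-y≈0 (reflexive (≡.sym ψi≡α))) v Fv)
      where
      inside : ∀ v → α - ψ v ≈ 0# → v ∈ W
      inside v p with uniform-weight W α 0<α v
      ... | inj₁ (v∈W , _)  = lookup⇒[]= v W v∈W
      ... | inj₂ (_ , ψv≡0) = ⊥-elim (0<⇒≉0 0<α (trans (x-y≈0⇒x≈y p) (reflexive ψv≡0)))
    conclude (inj₂ (_ , ψi≡0)) = inj₂ λ v Fv v∈W →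
      outside v v∈W (zero-on-relative-interior {b = b} {F} (λ Fx → proj₁ (F⊆ Fx))
        (affine ψ ψ-averages) 0≤ψ i i-interior (reflexive ψi≡0) v Fv)
      where
      outside : ∀ v → v ∈ W → ¬ (ψ v ≈ 0#)
      outside v v∈W p with uniform-weight W α 0<α v
      ... | inj₁ (_ , ψv≡α) = 0<⇒≉0 0<α (trans (reflexive (≡.sym ψv≡α)) p)
      ... | inj₂ (v∉W , _)  = true≢false (≡.trans (≡.sym ([]=⇒lookup v∈W)) v∉W)

  0<bary-o : ∀ v → high v ≡ false → 0# < bary o v
  0<bary-o v v-low = bool-cases (isFirst v)
    (λ v-first → ≡.subst (λ v → 0# < bary o v)
      (Fin.toℕ-injective (≡.trans o≡0 (≡.sym (isFirst⇒≡0 v v-first)))) 0<bary-oo)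
    (λ v-not-first → let v∉V = low⇒∉V v v-not-first v-low in
      averagesOff-pos (bary-averages o) (0≤bary o) v v∉V o (o< v v∉V) 0<bary-oo)
    where
    0<bary-oo : 0# < bary o o
    0<bary-oo = <-respʳ-≈ (sym (trans (bary-on o o (first∈V o o≡0)) (reflexive (δ-refl o)))) 0<1

  bary-o-high : ∀ v → high v ≡ true → bary o v ≈ 0#
  bary-o-high v v-high = trans (bary-on o v (high⇒V v v-high))
    (reflexive (δ-≢ λ o≡v →
      true≢false (≡.trans (≡.sym v-high) (≡.trans (≡.cong high (≡.sym o≡v)) (high-first o o≡0)))))

  high⊆V : ∀ v → V v ≡ false → high v ≡ false
  high⊆V v v∉V = proj₂ (∉V⇒ v v∉V)

  no-three-values : ∀ {x y z γ δ} → ¬ (x ≈ y) → ¬ (x ≈ z) → ¬ (y ≈ z) →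
    x ≈ γ ⊎ x ≈ δ → y ≈ γ ⊎ y ≈ δ → z ≈ γ ⊎ z ≈ δ → ⊥
  no-three-values x≉y x≉z y≉z (inj₁ p) (inj₁ q) _        = x≉y (trans p (sym q))
  no-three-values x≉y x≉z y≉z (inj₁ p) (inj₂ _) (inj₁ r) = x≉z (trans p (sym r))
  no-three-values x≉y x≉z y≉z (inj₁ _) (inj₂ q) (inj₂ r) = y≉z (trans q (sym r))
  no-three-values x≉y x≉z y≉z (inj₂ _) (inj₁ q) (inj₁ r) = y≉z (trans q (sym r))
  no-three-values x≉y x≉z y≉z (inj₂ p) (inj₁ _) (inj₂ r) = x≉z (trans p (sym r))
  no-three-values x≉y x≉z y≉z (inj₂ p) (inj₂ q) _        = x≉y (trans p (sym q))

  -- The facet opposite to the first point. Its functional χ is 1 minus the barycentric coordinate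
  -- `bary o`, so the normal separates `o`, `i₀` and `j₀` into three values.
  facet : Σ Region λ F → IsFacet (conv b) F × ∃[ a ] IsNormal (conv b) F a × ¬ IsTwoWitness b a
  facet =
      Hull high
    , ( (a , 1# - γ , cut)
      , proj₁ nonempty′
      , polytope-dimension
          (≡.trans (count-first high o high-first) (≡.cong suc (proj₂ nonempty′)))
      , dimension high high⊆V (proj₂ nonempty′))
    , a , (a≉0 , 1# - γ , cut) , not-two-witness
    where
    high-face = face high high⊆V
    a = proj₁ high-face
    γ = proj₁ (proj₂ high-face)
    cut = proj₁ (proj₂ (proj₂ high-face))
    χ≈ = proj₂ (proj₂ (proj₂ high-face))
    nonempty′ = count-suc high j₀ j₀-high
    χ = faceFunctional high high⊆V
    χ-on = faceFunctional-on high high⊆V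
    χo≈0 : χ o ≈ 0#
    χo≈0 = trans (χ-on o (first∈V o o≡0)) (reflexive (≡.cong (if_then 1# else 0#) (high-first o o≡0)))
    χj₀≈1 : χ j₀ ≈ 1#
    χj₀≈1 = trans (χ-on j₀ (high⇒V j₀ j₀-high)) (reflexive (≡.cong (if_then 1# else 0#) j₀-high))
    0≤χ : ∀ v → 0# ≤ χ v
    0≤χ = averagesOff-nonneg (faceFunctional-averages high high⊆V)
      (λ v v∈V → ≤-respʳ-≈ (sym (χ-on v v∈V)) (0≤⟦ high v ⟧))
    0<χi₀ : 0# < χ i₀
    0<χi₀ = averagesOff-pos (faceFunctional-averages high high⊆V) 0≤χ
      i₀ i₀∉V j₀ j₀<i₀ (<-respʳ-≈ (sym χj₀≈1) 0<1)
    χi₀<1 : χ i₀ < 1#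
    χi₀<1 = 0<y-x⇒x<y (<-≤-trans (0<bary-o i₀ i₀-low)
      (bary≤1-faceFunctional high high⊆V o i₀ (high-first o o≡0)))

    χ-from : ∀ v w → a ∙ b v ≈ a ∙ b w → χ v ≈ χ w
    χ-from v w p = trans (χ≈ v) (trans (+-congʳ p) (sym (χ≈ w)))

    a≉0 : ¬ (a ≋ 𝟎)
    a≉0 a≋0 = 1≉0 (trans (sym χj₀≈1) (trans (χ-from j₀ o (trans (a∙≈0 j₀) (sym (a∙≈0 o)))) χo≈0))
      where
      a∙≈0 : ∀ v → a ∙ b v ≈ 0#
      a∙≈0 v = sum-zero (λ r → trans (*-congʳ (a≋0 r)) (zeroˡ _))

    o≉j₀ : ¬ (a ∙ b o ≈ a ∙ b j₀)
    o≉j₀ p = <⇒≉ 0<1 (trans (sym χo≈0) (trans (χ-from o j₀ p) χj₀≈1))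
    o≉i₀ : ¬ (a ∙ b o ≈ a ∙ b i₀)
    o≉i₀ p = <⇒≉ 0<χi₀ (trans (sym χo≈0) (χ-from o i₀ p))
    i₀≉j₀ : ¬ (a ∙ b i₀ ≈ a ∙ b j₀)
    i₀≉j₀ p = <⇒≉ χi₀<1 (trans (χ-from i₀ j₀ p) χj₀≈1)

    not-two-witness : ¬ IsTwoWitness b a
    not-two-witness (_ , _ , _ , _ , _ , values) = no-three-values o≉i₀ o≉j₀ i₀≉j₀ (values o) (values i₀) (values j₀)

  W₀ : Subset n
  W₀ = tabulate (not ∘ high)

  lookup-W₀ : ∀ v → lookup W₀ v ≡ not (high v)
  lookup-W₀ = lookup∘tabulate (not ∘ high)

  ∈W₀⇒low : ∀ {v} → v ∈ W₀ → high v ≡ false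
  ∈W₀⇒low {v} v∈W₀ = ≡.trans (≡.sym (Bool.not-involutive (high v)))
    (≡.cong not (≡.trans (≡.sym (lookup-W₀ v)) ([]=⇒lookup v∈W₀)))

  total : Carrier
  total = sum (bary o)

  0<total : 0# < total
  0<total = sum-pos (0≤bary o) o (0<bary-o o (high-first o o≡0))

  a₀ : Vec n
  a₀ v = total ⁻¹ * bary o v

  W₀-design : IsDesign W₀ a₀
  -- Pairing `bary o` with a low function f gives γ · sum f, with γ the constant term of its affine
  -- form. Taking f = 1 shows `total` = nγ, so γ drops out after normalisation. The identity is
  -- checked after multiplying by `total` and n.
  W₀-design f f-low = *-cancelˡ (0<⇒≉0 (*-pos 0<total (0<n o))) (begin
    (total * N) * (N ⁻¹ * sum f)
      ≈⟨ trans (*-assoc _ _ _) (*-congˡ (x*[x⁻¹*y]≈y (sum f) (0<⇒≉0 (0<n o)))) ⟩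
    total * sum f
      ≈⟨ *-congʳ total≈Nγ ⟩
    (N * γ) * sum f
      ≈⟨ solve 3 (λ x y z → (x :* y) :* z := x :* (z :* y)) refl N γ (sum f) ⟩
    N * (sum f * γ)
      ≈⟨ *-congˡ (affine-annihilated bary-affine f (lowSum-annihilates f-low)) ⟨
    N * (f ∙ bary o)
      ≈⟨ *-congˡ (x*[x⁻¹*y]≈y (f ∙ bary o) (0<⇒≉0 0<total)) ⟨
    N * (total * (total ⁻¹ * (f ∙ bary o)))
      ≈⟨ solve 3 (λ x y z → x :* (y :* z) := (y :* x) :* z) refl N total _ ⟩
    (total * N) * (total ⁻¹ * (f ∙ bary o))
      ≈⟨ *-congˡ (sym (trans (sum-cong-≋ summand) (∑-*ˡ (total ⁻¹) (λ v → f v * bary o v)))) ⟩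
    (total * N) * sum (λ v → if lookup W₀ v then a₀ v * f v else 0#) ∎)
    where
    N = n · 1#
    bary-affine = affine (bary o) (bary-averages o)
    γ = proj₁ (proj₂ bary-affine)
    total≈Nγ : total ≈ N * γ
    total≈Nγ = begin
      sum (bary o)                  ≈⟨ sum-cong-≋ (λ v → sym (*-identityˡ (bary o v))) ⟩
      (λ _ → 1#) ∙ bary o           ≈⟨ affine-annihilated bary-affine (λ _ → 1#) (lowSum-annihilates constant∈lowSum) ⟩
      sum {n} (λ _ → 1#) * γ        ≈⟨ *-congʳ (sum-1 n) ⟩
      N * γ                         ∎
    summand : ∀ v → (if lookup W₀ v then a₀ v * f v else 0#) ≈ total ⁻¹ * (f v * bary o v)
    summand v rewrite lookup-W₀ v with high v in eq
    ... | false = solve 3 (λ x y z → (x :* y) :* z := x :* (z :* y)) refl (total ⁻¹) (bary o v) (f v)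
    ... | true  = sym (trans (*-congˡ (trans (*-congˡ (bary-o-high v eq)) (zeroʳ _))) (zeroʳ _))

  -- Weights vanishing on all high vertices are the multiple ψ o of `bary o`, by uniqueness. Since
  -- `bary o` is positive on all of `W₀`, dropping a single vertex forces ψ = 0, against total
  -- weight 1.
  W₀-minimal : ∀ W → W ⊂ W₀ → ¬ PositiveDesign W
  W₀-minimal W (W⊆W₀ , x , x∈W₀ , x∉W) (a , _ , W-design) = 1≉0 (begin
    1#                            ≈⟨ design⇒sum-weight W a W-design ⟨
    sum ψ                         ≈⟨ sum-zero (λ v → trans (ψ≈ v) (trans (*-congʳ ψo≈0) (zeroˡ _))) ⟩
    0#                            ∎)
    where
    ψ : Vec n
    ψ = weight W a
    ψ-outside : ∀ v → v ∉ W → ψ v ≈ 0#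
    ψ-outside v v∉W with lookup W v in eq
    ... | true  = ⊥-elim (v∉W (lookup⇒[]= v W eq))
    ... | false = refl
    ψ-on : ∀ v → V v ≡ true → ψ v ≈ ψ o * bary o v
    ψ-on v v∈V with o Fin.≟ v
    ... | yes ≡.refl = sym (trans (*-congˡ (trans (bary-on o o v∈V) (reflexive (δ-refl o)))) (*-identityʳ (ψ o)))
    ... | no  o≢v    = trans
      (ψ-outside v (λ v∈W → true≢false (≡.trans (≡.sym v-high) (∈W₀⇒low (W⊆W₀ v∈W)))))
      (sym (trans (*-congˡ (bary-o-high v v-high)) (zeroʳ _)))
      where
      v-high : high v ≡ true
      v-high = bool-cases (isFirst v)
        (λ v-first → ⊥-elim (o≢v (Fin.toℕ-injective (≡.trans o≡0 (≡.sym (isFirst⇒≡0 v v-first))))))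
        (λ v-not-first → ≡.trans (≡.sym (≡.cong (_∨ high v) v-not-first)) v∈V)
    ψ≈ : ∀ v → ψ v ≈ ψ o * bary o v
    ψ≈ = averagesOff-unique {ψ} {λ v → ψ o * bary o v} (design⇒averages W a W-design)
      (λ v v∉V → trans (solve 3 (λ x y z → x :* (y :* z) := y :* (x :* z)) refl (toℕ v · 1#) (ψ o) (bary o v))
        (trans (*-congˡ (bary-averages o v v∉V)) (trans (*-distribˡ-sum (ψ o) (λ j → below v j * bary o j))
          (sum-cong-≋ (λ j → solve 3 (λ x y z → x :* (y :* z) := y :* (x :* z)) refl (ψ o) (below v j) (bary o j))))))
      ψ-on
    ψo≈0 : ψ o ≈ 0#
    ψo≈0 = *-zero-cancelˡ (0<⇒≉0 (0<bary-o x (∈W₀⇒low x∈W₀)))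
      (trans (*-comm _ _) (trans (sym (ψ≈ x)) (ψ-outside x x∉W)))

  W₀-minimal-positive : MinimalPositiveDesign W₀
  W₀-minimal-positive =
      (a₀ , (λ w w∈W₀ → *-pos (⁻¹-pos 0<total) (0<bary-o w (∈W₀⇒low w∈W₀))) , W₀-design)
    , W₀-minimal

  -- For a uniform weight, α - ψ would be nonnegative with the averaging rule and equal to α at
  -- `j₀`, hence positive at `i₀`; but `i₀` lies in `W₀`, where it is zero.
  W₀-not-uniform : ¬ UniformDesign W₀
  W₀-not-uniform (α , 0<α , W-design) = 0<⇒≉0
    (averagesOff-pos {λ v → α - ψ v}
      (averagesOff-sub (averagesOff-const α) (design⇒averages W₀ (λ _ → α) W-design)) (0≤α-weight W₀ 0<α)
      i₀ i₀∉V j₀ j₀<i₀ (<-respʳ-≈ (sym (trans (+-congˡ (-‿cong (reflexive ψj₀≡0)))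
        (solve 1 (λ x → x :- con (+ 0) := x) refl α))) 0<α))
    (x≈y⇒x-y≈0 (reflexive (≡.sym ψi₀≡α)))
    where
    ψ : Vec n
    ψ = weight W₀ (λ _ → α)
    ψj₀≡0 : ψ j₀ ≡ 0#
    ψj₀≡0 = ≡.cong (if_then α else 0#) (≡.trans (lookup-W₀ j₀) (≡.cong not j₀-high))
    ψi₀≡α : ψ i₀ ≡ α
    ψi₀≡α = ≡.cong (if_then α else 0#) (≡.trans (lookup-W₀ i₀) (≡.cong not i₀-low))

  non-uniform-minimal-design : ∃[ W ] MinimalPositiveDesign W × ¬ UniformDesign W
  non-uniform-minimal-design = W₀ , W₀-minimal-positive , W₀-not-uniform

open import Data.Nat.Base using (_+_; _≤_; _<_)

theorem4p8 :
    ∀ {c ℓ₁ ℓ₂ : Level} (𝕂 : OrderedField c ℓ₁ ℓ₂) →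
    let open Eigenpolytopes 𝕂 in
    ∀ {n k t β : ℕ} (G : Graph n) →
    Graph.IsThreshold G → Graph.Connected G →
    IntervalSplitting G k → 2 < k → 1 ≤ t → t + 2 ≤ k →
    (S : Spectrum G k) (B : Vector (Vec n) β) → IsEigenbasisMatrix S t B →
    let open Designs S t
        b = columns B
        P = conv b
        Region = Pred (Vec β) (c ⊔ ℓ₁ ⊔ ℓ₂)
    in
    IsSimplex P ×
    (Σ Region λ F → IsInteriorFace b F) ×
    (∀ (F : Region) → IsInteriorFace b F →
     ∀ (W : Subset n) → UniformDesign W →
       (∀ i → F (b i) → i ∈ W) ⊎ (∀ i → F (b i) → i ∉ W)) ×
    (Σ Region λ F → IsFacet P F × ∃[ a ] IsNormal P F a × ¬ IsTwoWitness b a) ×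
    (∃[ W ] MinimalPositiveDesign W × ¬ UniformDesign W)
theorem4p8 𝕂 G threshold connected splitting 2<k 1≤t t+2≤k S B B-basis =
    ThresholdDesigns.P-simplex 𝕂 G threshold connected splitting 2<k 1≤t t+2≤k S B B-basis
  , ThresholdDesigns.interior-face 𝕂 G threshold connected splitting 2<k 1≤t t+2≤k S B B-basis
  , ThresholdDesigns.uniform-designs-contain-all-or-none 𝕂 G threshold connected splitting 2<k 1≤t t+2≤k S B B-basis
  , ThresholdDesigns.facet 𝕂 G threshold connected splitting 2<k 1≤t t+2≤k S B B-basis
  , ThresholdDesigns.non-uniform-minimal-design 𝕂 G threshold connected splitting 2<k 1≤t t+2≤k S B B-basis
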